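{- For every problem $f$: (1) $f\leq_{\mathrm{sW}}\Sigma\Pi f\iff\Pi f\equiv_{\mathrm{sW}}\Sigma\Pi f$; (2) $\Sigma\Pi f\leq_{\mathrm{sW}}f\iff\Sigma f\equiv_{\mathrm{sW}}\Sigma\Pi f$; (3) $f\leq_{\mathrm{sW}}\Pi\Sigma f\iff\Pi f\equiv_{\mathrm{sW}}\Pi\Sigma f$; (4) $\Pi\Sigma f\leq_{\mathrm{sW}}f\iff\Sigma f\equiv_{\mathrm{sW}}\Pi\Sigma f$. Analogous statements hold with $\leq_{\mathrm{sW}}$ (and its induced equivalence $\equiv_{\mathrm{sW}}$) replaced throughout by any of $\leq_{\mathrm W}$, $\leq_{\mathrm{sW}}^*$, $\leq_{\mathrm W}^*$ (and the respective induced equivalence).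
   Context: A represented space is a set $X$ with a partial surjective map $\delta_X:\subseteq\mathbb N^{\mathbb N}\to X$. A problem is a partial multi-valued function $f:\subseteq X\rightrightarrows Y$ between represented spaces that has a realizer; a realizer of $f$ is a function $F:\subseteq\mathbb N^{\mathbb N}\to\mathbb N^{\mathbb N}$ with $\delta_YF(p)\in f\delta_X(p)$ for all $p\in\mathrm{dom}(f\delta_X)$. For $p,q\in\mathbb N^{\mathbb N}$, $\langle p,q\rangle(2n)=p(n)$, $\langle p,q\rangle(2n+1)=q(n)$. For problems $f,g$: $f\leq_{\mathrm W}g$ if there are computable $H,K:\subseteq\mathbb N^{\mathbb N}\to\mathbb N^{\mathbb N}$ such that $H\langle\mathrm{id},GK\rangle$ is a realizer of $f$ whenever $G$ is a realizer of $g$; $f\leq_{\mathrm{sW}}g$ is defined likewise with $HGK$ instead of $H\langle\mathrm{id},GK\rangle$. $\leq_{\mathrm W}^*$ and $\leq_{\mathrm{sW}}^*$ are defined likewise with continuous instead of computable $H,K$. The equivalence induced by a reducibility $\leq$ is reducibility in both directions. For a represented space $Y$, the completion $\overline Y:=Y\cup\{\bot\}$ ($\bot\notin Y$) is represented by the total map $\delta_{\overline Y}$ with $\delta_{\overline Y}(p)=\delta_Y(p-1)$ if $p-1\in\mathrm{dom}(\delta_Y)$ and $\delta_{\overline Y}(p)=\bot$ otherwise, where $p-1\in\mathbb N^{\mathbb N}\cup\mathbb N^*$ is the concatenation of $p(0)-1,p(1)-1,\dots$ and $0-1$ is the empty word. $X^{\mathbb N}$ is represented by $\langle p_0,p_1,\dots\rangle\mapsto(\delta_X(p_n))_n$,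 where $\langle p_0,p_1,\dots\rangle\langle n,k\rangle:=p_n(k)$ and $\langle n,k\rangle:=\frac12(n+k)(n+k+1)+k$ for $n,k\in\mathbb N$. For $f:\subseteq X\rightrightarrows Y$: the parallelization $\Pi f:\subseteq X^{\mathbb N}\rightrightarrows Y^{\mathbb N}$ has domain $\mathrm{dom}(f)^{\mathbb N}$ and $\Pi f((x_n)_n)=\{(y_n)_n:(\forall n)\ y_n\in f(x_n)\}$; the stashing $\Sigma f:\subseteq X^{\mathbb N}\rightrightarrows\overline Y^{\mathbb N}$ has domain $\mathrm{dom}(f)^{\mathbb N}$ and $\Sigma f((x_n)_n)=\{(y_n)_n\in\overline Y^{\mathbb N}:(\exists n)\ y_n\in f(x_n)\}$. Words such as $\Pi\Sigma f$ denote iterated application, $\Pi\Sigma f=\Pi(\Sigma f)$. -}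

module Defs where

open import Axiom.ExcludedMiddle using (ExcludedMiddle)
open import Data.Fin using (Fin)
open import Data.List using (List; []; _∷_; concatMap; applyUpTo)
open import Data.List.Properties using (∷-injective)
open import Data.Maybe using (Maybe; just; nothing)
import Data.Maybe.Relation.Binary.Pointwise as Maybe
open import Data.Nat using (ℕ; zero; suc; _+_; _*_; _<_; s≤s)
open import Data.Nat.DivMod using (_/_; +-distrib-/-∣ˡ; m*n/n≡m)
open import Data.Nat.Divisibility using (n∣m*n)
open import Data.Nat.Properties using (+-identityʳ; +-suc; +-comm; suc-injective; n<1+n)
open import Data.Nat.Tactic.RingSolver using (solve-∀)
open import Data.Product using (∃; ∃₂; _×_; _,_; proj₁; proj₂; uncurry)
open import Data.Vec using (Vec; []; _∷_; lookup)
open import Data.Vec.Relation.Binary.Pointwise.Inductive using (Pointwise)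
open import Function using (_∘_)
open import Level using (0ℓ)
open import Relation.Binary using (Setoid)
open import Relation.Binary.PropositionalEquality
  using (_≡_; refl; sym; trans; cong; cong₂; subst; _≗_; _→-setoid_; module ≡-Reasoning)
open import Relation.Nullary using (¬_; contradiction; yes; no)

open Setoid using (Carrier)

-- Sets are setoids.  A partial multi-valued function is a relation: f(x)
-- is the set of all y with  y ∈ f [ x ],  and dom(f) consists of the x
-- for which f(x) is inhabited.

record _⇉_ (A B : Setoid 0ℓ 0ℓ) : Set₁ where
  private
    module A = Setoid A
    module B = Setoid B
  field
    Graph : A.Carrier → B.Carrier → Set
    resp  : ∀ {x x′ y y′} → x A.≈ x′ → y B.≈ y′ → Graph x y → Graph x′ y′

infix 4 _∈_[_]

_∈_[_] : ∀ {A B} → Carrier B → A ⇉ B → Carrier A → Set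
y ∈ f [ x ] = _⇉_.Graph f x y

dom : ∀ {A B} → A ⇉ B → Carrier A → Set
dom f x = ∃ λ y → y ∈ f [ x ]

record _⇀_ (A B : Setoid 0ℓ 0ℓ) : Set₁ where
  private
    module B = Setoid B
  field
    multi        : A ⇉ B
    singleValued : ∀ {x y y′} → y ∈ multi [ x ] → y′ ∈ multi [ x ] → y B.≈ y′

open _⇀_ using (multi)

infix 4 _∋_↦_

_∋_↦_ : ∀ {A B} → A ⇀ B → Carrier A → Carrier B → Set
F ∋ x ↦ y = y ∈ multi F [ x ]

infixr 9 _∘⇀_

_∘⇀_ : ∀ {A B C} → B ⇀ C → A ⇀ B → A ⇀ C
_∘⇀_ {A} {B} {C} F G = record
  { multi = record
    { Graph = λ x z → ∃ λ y → (G ∋ x ↦ y) × (F ∋ y ↦ z)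
    ; resp  = λ x≈ z≈ (y , g , h) →
        y , _⇉_.resp (multi G) x≈ (Setoid.refl B) g
          , _⇉_.resp (multi F) (Setoid.refl B) z≈ h
    }
  ; singleValued = λ (_ , g , h) (_ , g′ , h′) →
      _⇀_.singleValued F
        (_⇉_.resp (multi F) (_⇀_.singleValued G g g′) (Setoid.refl C) h) h′
  }

Baire : Setoid 0ℓ 0ℓ
Baire = ℕ →-setoid ℕ

ℕ^ℕ : Set
ℕ^ℕ = Carrier Baire

⟨_,_⟩ : ℕ^ℕ → ℕ^ℕ → ℕ^ℕ
⟨ p , q ⟩ zero    = p zero
⟨ p , q ⟩ (suc m) = ⟨ q , p ∘ suc ⟩ m

⟨,⟩-even : ∀ p q n → ⟨ p , q ⟩ (2 * n) ≡ p n
⟨,⟩-odd  : ∀ p q n → ⟨ p , q ⟩ (2 * n + 1) ≡ q n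
⟨,⟩-even p q zero    = refl
⟨,⟩-even p q (suc n) =
  trans (cong ⟨ p , q ⟩ (lem n)) (⟨,⟩-odd q (p ∘ suc) n)
  where
  lem : ∀ n → 2 * suc n ≡ suc (2 * n + 1)
  lem = solve-∀
⟨,⟩-odd p q n =
  trans (cong ⟨ p , q ⟩ (+-comm (2 * n) 1)) (⟨,⟩-even q (p ∘ suc) n)

⟨,⟩-cong : ∀ {p p′ q q′} → p ≗ p′ → q ≗ q′ → ⟨ p , q ⟩ ≗ ⟨ p′ , q′ ⟩
⟨,⟩-cong p≗ q≗ zero    = p≗ zero
⟨,⟩-cong p≗ q≗ (suc m) = ⟨,⟩-cong q≗ (p≗ ∘ suc) m

⟨id,_⟩ : Baire ⇀ Baire → Baire ⇀ Baire
⟨id, F ⟩ = record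
  { multi = record
    { Graph = λ p r → ∃ λ q → (F ∋ p ↦ q) × r ≗ ⟨ p , q ⟩
    ; resp  = λ p≗ r≗ (q , f , e) →
        q , _⇉_.resp (multi F) p≗ (Setoid.refl Baire) f
          , λ i → trans (sym (r≗ i)) (trans (e i) (⟨,⟩-cong p≗ (λ _ → refl) i))
    }
  ; singleValued = λ (_ , f , e) (_ , f′ , e′) i →
      trans (e i)
        (trans (⟨,⟩-cong (λ _ → refl) (_⇀_.singleValued F f f′) i) (sym (e′ i)))
  }

pair : ℕ → ℕ → ℕ
pair n k = (n + k) * (n + k + 1) / 2 + k

unpair : ℕ → ℕ × ℕ
unpair zero    = 0 , 0
unpair (suc m) = next (unpair m)
  where
  next : ℕ × ℕ → ℕ × ℕ
  next (zero  , k) = suc k , 0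
  next (suc n , k) = n , suc k

pair-along : ∀ n k → pair n (suc k) ≡ suc (pair (suc n) k)
pair-along n k rewrite +-suc n k = +-suc _ k

pair-turn : ∀ k → pair (suc k) 0 ≡ suc (pair 0 k)
pair-turn k = begin
  (suc k + 0) * (suc k + 0 + 1) / 2 + 0  ≡⟨ +-identityʳ _ ⟩
  (suc k + 0) * (suc k + 0 + 1) / 2      ≡⟨ cong (_/ 2) (lem k) ⟩
  (suc k * 2 + k * (k + 1)) / 2          ≡⟨ +-distrib-/-∣ˡ (k * (k + 1)) (n∣m*n (suc k)) ⟩
  suc k * 2 / 2 + k * (k + 1) / 2        ≡⟨ cong (_+ k * (k + 1) / 2) (m*n/n≡m (suc k) 2) ⟩
  suc k + k * (k + 1) / 2                ≡⟨ cong suc (+-comm k _) ⟩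
  suc (k * (k + 1) / 2 + k)              ∎
  where
  open ≡-Reasoning
  lem : ∀ k → (suc k + 0) * (suc k + 0 + 1) ≡ suc k * 2 + k * (k + 1)
  lem = solve-∀

unpair-pair : ∀ n k → unpair (pair n k) ≡ (n , k)
unpair-pair n k = go (n + k) n k refl
  where
  go : ∀ s n k → n + k ≡ s → unpair (pair n k) ≡ (n , k)
  go zero    zero    zero    _ = refl
  go (suc s) (suc n) zero    e
    rewrite pair-turn n | go s 0 n (suc-injective (trans (cong suc (sym (+-identityʳ n))) e))
    = refl
  go s       n       (suc k) e
    rewrite pair-along n k | go s (suc n) k (trans (sym (+-suc n k)) e)
    = refl

-- As pair is a bijection, every p is ⟨p₀,p₁,…⟩ for exactly one sequence
-- of pₙ, namely for pₙ = component p n.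

component : ℕ^ℕ → ℕ → ℕ^ℕ
component p n k = p (pair n k)

tuple : (ℕ → ℕ^ℕ) → ℕ^ℕ
tuple ps = uncurry ps ∘ unpair

component-tuple : ∀ ps n → component (tuple ps) n ≗ ps n
component-tuple ps n k = cong (uncurry ps) (unpair-pair n k)

-- Partial recursive functions with an oracle in ℕ^ℕ.

data Code : ℕ → Set where
  zero   : ∀ {n} → Code n
  suc    : Code 1
  proj   : ∀ {n} → Fin n → Code n
  oracle : Code 1
  comp   : ∀ {m n} → Code m → Vec (Code n) m → Code n
  prec   : ∀ {n} → Code n → Code (2 + n) → Code (1 + n)
  μ      : ∀ {n} → Code (1 + n) → Code n

infix 4 _⊢_[_]⇓_

data _⊢_[_]⇓_ (p : ℕ^ℕ) : ∀ {n} → Code n → Vec ℕ n → ℕ → Set where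
  zero⇓   : ∀ {n} {xs : Vec ℕ n} → p ⊢ zero [ xs ]⇓ 0
  suc⇓    : ∀ {x} → p ⊢ suc [ x ∷ [] ]⇓ suc x
  proj⇓   : ∀ {n} {xs : Vec ℕ n} (i : Fin n) → p ⊢ proj i [ xs ]⇓ lookup xs i
  oracle⇓ : ∀ {x} → p ⊢ oracle [ x ∷ [] ]⇓ p x
  comp⇓   : ∀ {m n} {c : Code m} {ds : Vec (Code n) m} {xs : Vec ℕ n} {ys : Vec ℕ m} {z} →
            Pointwise (λ d y → p ⊢ d [ xs ]⇓ y) ds ys →
            p ⊢ c [ ys ]⇓ z →
            p ⊢ comp c ds [ xs ]⇓ z
  prec-z⇓ : ∀ {n} {c : Code n} {d : Code (2 + n)} {xs : Vec ℕ n} {z} →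
            p ⊢ c [ xs ]⇓ z →
            p ⊢ prec c d [ 0 ∷ xs ]⇓ z
  prec-s⇓ : ∀ {n} {c : Code n} {d : Code (2 + n)} {x} {xs : Vec ℕ n} {y z} →
            p ⊢ prec c d [ x ∷ xs ]⇓ y →
            p ⊢ d [ x ∷ y ∷ xs ]⇓ z →
            p ⊢ prec c d [ suc x ∷ xs ]⇓ z
  μ⇓      : ∀ {n} {c : Code (1 + n)} {xs : Vec ℕ n} {y} →
            p ⊢ c [ y ∷ xs ]⇓ 0 →
            (∀ x → x < y → ∃ λ v → p ⊢ c [ x ∷ xs ]⇓ suc v) →
            p ⊢ μ c [ xs ]⇓ y

-- As usual in computable analysis, the algorithm is only constrained on
-- the domain of F.

Computable : Baire ⇀ Baire → Set
Computable F = ∃ λ (c : Code 1) → ∀ p q → F ∋ p ↦ q → ∀ n → p ⊢ c [ n ∷ [] ]⇓ q n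

_≗[_]_ : ℕ^ℕ → ℕ → ℕ^ℕ → Set
p ≗[ n ] q = ∀ i → i < n → p i ≡ q i

Continuous : Baire ⇀ Baire → Set
Continuous F = ∀ p q → F ∋ p ↦ q → ∀ n →
  ∃ λ m → ∀ p′ q′ → F ∋ p′ ↦ q′ → p ≗[ m ] p′ → q ≗[ n ] q′

record RepresentedSpace : Set₁ where
  field
    space      : Setoid 0ℓ 0ℓ
    δ          : Baire ⇀ space
    surjective : ∀ x → ∃ λ p → δ ∋ p ↦ x

open RepresentedSpace using (space; δ; surjective)

sequences : Setoid 0ℓ 0ℓ → Setoid 0ℓ 0ℓ
sequences A = record
  { Carrier       = ℕ → A.Carrier
  ; _≈_           = λ xs ys → ∀ n → xs n A.≈ ys n
  ; isEquivalence = record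
    { refl  = λ _ → A.refl
    ; sym   = λ e n → A.sym (e n)
    ; trans = λ e e′ n → A.trans (e n) (e′ n)
    }
  }
  where module A = Setoid A

_^ℕ : RepresentedSpace → RepresentedSpace
X ^ℕ = record
  { space = sequences (space X)
  ; δ     = record
    { multi = record
      { Graph = λ p xs → ∀ n → δ X ∋ component p n ↦ xs n
      ; resp  = λ p≗ xs≈ d n → _⇉_.resp (multi (δ X)) (λ k → p≗ (pair n k)) (xs≈ n) (d n)
      }
    ; singleValued = λ d d′ n → _⇀_.singleValued (δ X) (d n) (d′ n)
    }
  ; surjective = λ xs →
      tuple (proj₁ ∘ surjective X ∘ xs) ,
      λ n → _⇉_.resp (multi (δ X))
              (λ k → sym (component-tuple (proj₁ ∘ surjective X ∘ xs) n k))
              (Setoid.refl (space X))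
              (proj₂ (surjective X (xs n)))
  }

letter-1 : ℕ → List ℕ
letter-1 zero    = []
letter-1 (suc a) = a ∷ []

word-1 : ℕ^ℕ → ℕ → List ℕ
word-1 p m = concatMap letter-1 (applyUpTo p m)

-- p -1≗ q  says that p-1 is infinite and equal to q: as each letter-1 a
-- has length at most one, the words  word-1 p m  run through all finite
-- prefixes of p-1.

_-1≗_ : ℕ^ℕ → ℕ^ℕ → Set
p -1≗ q = ∀ k → ∃ λ m → word-1 p m ≡ applyUpTo q k

applyUpTo-cong : ∀ {p q : ℕ^ℕ} → p ≗ q → applyUpTo p ≗ applyUpTo q
applyUpTo-cong e zero    = refl
applyUpTo-cong e (suc m) = cong₂ _∷_ (e 0) (applyUpTo-cong (e ∘ suc) m)

word-1-unique : ∀ p q q′ m m′ k → word-1 p m ≡ applyUpTo q k →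
                word-1 p m′ ≡ applyUpTo q′ k → q ≗[ k ] q′
word-1-unique p q q′ zero    m′       (suc k) () e′ i i<k
word-1-unique p q q′ (suc m) zero     (suc k) e () i i<k
word-1-unique p q q′ (suc m) (suc m′) (suc k) e e′ i i<k with p 0
... | zero  = word-1-unique (p ∘ suc) q q′ m m′ (suc k) e e′ i i<k
word-1-unique p q q′ (suc m) (suc m′) (suc k) e e′ zero i<k | suc a =
  trans (sym (proj₁ (∷-injective e))) (proj₁ (∷-injective e′))
word-1-unique p q q′ (suc m) (suc m′) (suc k) e e′ (suc i) (s≤s i<k) | suc a =
  word-1-unique (p ∘ suc) (q ∘ suc) (q′ ∘ suc) m m′ k
    (proj₂ (∷-injective e)) (proj₂ (∷-injective e′)) i i<k

word-1-suc : ∀ q m → word-1 (suc ∘ q) m ≡ applyUpTo q m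
word-1-suc q zero    = refl
word-1-suc q (suc m) = cong (q 0 ∷_) (word-1-suc (q ∘ suc) m)

word-1-zero : ∀ m → word-1 (λ _ → 0) m ≡ []
word-1-zero zero    = refl
word-1-zero (suc m) = word-1-zero m

-1≗-respˡ : ∀ {p p′ q} → p ≗ p′ → p -1≗ q → p′ -1≗ q
-1≗-respˡ p≗ e k =
  proj₁ (e k) ,
  trans (cong (concatMap letter-1) (sym (applyUpTo-cong p≗ (proj₁ (e k))))) (proj₂ (e k))

-1≗-unique : ∀ {p q q′} → p -1≗ q → p -1≗ q′ → q ≗ q′
-1≗-unique {p} {q} {q′} e e′ i =
  word-1-unique p q q′ (proj₁ (e (suc i))) (proj₁ (e′ (suc i))) (suc i)
    (proj₂ (e (suc i))) (proj₂ (e′ (suc i))) i (n<1+n i)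

suc-1≗ : ∀ q → (suc ∘ q) -1≗ q
suc-1≗ q k = k , word-1-suc q k

-- The element  nothing  is ⊥.  The case distinction that makes the
-- representation a total map is an instance of excluded middle.

completion : RepresentedSpace → RepresentedSpace
completion Y = record
  { space = Maybe.setoid (space Y)
  ; δ     = record
    { multi        = record { Graph = Name ; resp = resp }
    ; singleValued = singleValued
    }
  ; surjective = onto
  }
  where
  module Y = Setoid (space Y)

  Name : ℕ^ℕ → Maybe Y.Carrier → Set
  Name p (just y) = ∃ λ q → p -1≗ q × (δ Y ∋ q ↦ y)
  Name p nothing  = ¬ (∃₂ λ q y → p -1≗ q × (δ Y ∋ q ↦ y))

  resp : ∀ {p p′ y y′} → p ≗ p′ → Maybe.Pointwise Y._≈_ y y′ → Name p y → Name p′ y′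
  resp p≗ (Maybe.just y≈) (q , e , d) =
    q , -1≗-respˡ p≗ e , _⇉_.resp (multi (δ Y)) (λ _ → refl) y≈ d
  resp p≗ Maybe.nothing   ¬d (q , y , e , d) =
    ¬d (q , y , -1≗-respˡ (λ i → sym (p≗ i)) e , d)

  singleValued : ∀ {p y y′} → Name p y → Name p y′ → Maybe.Pointwise Y._≈_ y y′
  singleValued {y = just _}  {just _}  (_ , e , d) (_ , e′ , d′) =
    Maybe.just (_⇀_.singleValued (δ Y)
      (_⇉_.resp (multi (δ Y)) (-1≗-unique e e′) Y.refl d) d′)
  singleValued {y = just y}  {nothing} (q , ed) ¬d = contradiction (q , y , ed) ¬d
  singleValued {y = nothing} {just y}  ¬d (q , ed) = contradiction (q , y , ed) ¬d
  singleValued {y = nothing} {nothing} _ _ = Maybe.nothing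

  onto : ∀ y → ∃ λ p → Name p y
  onto (just y) = let q , d = surjective Y y in suc ∘ q , q , suc-1≗ q , d
  onto nothing  = (λ _ → 0) , λ (q , _ , e , _) →
    contradiction (trans (sym (word-1-zero (proj₁ (e 1)))) (proj₂ (e 1))) λ ()

_IsRealizerOf_ : ∀ {X Y} → Baire ⇀ Baire → space X ⇉ space Y → Set
_IsRealizerOf_ {X} {Y} F f =
  ∀ p x → δ X ∋ p ↦ x → dom f x →
  ∃ λ q → (F ∋ p ↦ q) × ∃ λ y → (δ Y ∋ q ↦ y) × y ∈ f [ x ]

record Problem : Set₁ where
  field
    source target : RepresentedSpace
    fun           : space source ⇉ space target
    realizable    : ∃ λ F → _IsRealizerOf_ {source} {target} F fun

_Realizes_ : Baire ⇀ Baire → Problem → Set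
F Realizes f = _IsRealizerOf_ {source} {target} F fun
  where open Problem f

completion-total : ExcludedMiddle 0ℓ → ∀ Y p → dom (multi (δ (completion Y))) p
completion-total em Y p with em {∃₂ λ q y → p -1≗ q × (δ Y ∋ q ↦ y)}
... | yes (q , y , ed) = just y , q , ed
... | no ¬d            = nothing , ¬d

parallelization : ∀ {A B} → A ⇉ B → sequences A ⇉ sequences B
parallelization f = record
  { Graph = λ xs ys → ∀ n → ys n ∈ f [ xs n ]
  ; resp  = λ xs≈ ys≈ g n → _⇉_.resp f (xs≈ n) (ys≈ n) (g n)
  }

stashing : ∀ {A B} → A ⇉ B → sequences A ⇉ sequences (Maybe.setoid B)
stashing {A} {B} f = record
  { Graph = λ xs ys → (∀ n → dom f (xs n)) ×
                      ∃₂ λ n y → ys n B?.≈ just y × y ∈ f [ xs n ]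
  ; resp  = λ xs≈ ys≈ (d , n , y , e , g) →
      (λ i → let z , h = d i in z , _⇉_.resp f (xs≈ i) (Setoid.refl B) h) ,
      n , y , B?.trans (B?.sym (ys≈ n)) e , _⇉_.resp f (xs≈ n) (Setoid.refl B) g
  }
  where module B? = Setoid (Maybe.setoid B)

-- p ↦ ⟨h(F(p₀)),h(F(p₁)),…⟩
componentwise : (h : ℕ → ℕ) → Baire ⇀ Baire → Baire ⇀ Baire
componentwise h F = record
  { multi = record
    { Graph = λ p r → ∃ λ qs → (∀ n → F ∋ component p n ↦ qs n) × r ≗ h ∘ tuple qs
    ; resp  = λ p≗ r≗ (qs , f , e) →
        qs , (λ n → _⇉_.resp (multi F) (λ k → p≗ (pair n k)) (λ _ → refl) (f n))
           , λ i → trans (sym (r≗ i)) (e i)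
    }
  ; singleValued = λ (_ , f , e) (_ , f′ , e′) i →
      trans (e i) (trans
        (cong h (let n , k = unpair i in _⇀_.singleValued F (f n) (f′ n) k))
        (sym (e′ i)))
  }

Π : Problem → Problem
Π f = record
  { source     = source ^ℕ
  ; target     = target ^ℕ
  ; fun        = parallelization fun
  ; realizable = componentwise (λ a → a) F , λ p xs d (ys , g) →
      let r : ∀ n → _
          r n = realizes (component p n) (xs n) (d n) (ys n , g n)
          qs  = λ n → proj₁ (r n)
      in tuple qs , (qs , (λ n → proj₁ (proj₂ (r n))) , λ _ → refl) ,
         (λ n → proj₁ (proj₂ (proj₂ (r n)))) ,
         (λ n → _⇉_.resp (multi (δ target)) (λ k → sym (component-tuple qs n k))
                  (Setoid.refl (space target)) (proj₁ (proj₂ (proj₂ (proj₂ (r n)))))) ,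
         (λ n → proj₂ (proj₂ (proj₂ (proj₂ (r n)))))
  }
  where
  open Problem f
  F        = proj₁ realizable
  realizes = proj₂ realizable

Σ : Problem → Problem
Σ f = record
  { source     = source ^ℕ
  ; target     = completion target ^ℕ
  ; fun        = stashing fun
  ; realizable = componentwise suc F , λ p xs d (_ , g , _) →
      let r : ∀ n → _
          r n = realizes (component p n) (xs n) (d n) (g n)
          qs  = λ n → proj₁ (r n)
          y   = λ n → proj₁ (proj₂ (proj₂ (r n)))
      in suc ∘ tuple qs , (qs , (λ n → proj₁ (proj₂ (r n))) , λ _ → refl) ,
         (λ n → just (y n)) ,
         (λ n → component (tuple qs) n , suc-1≗ (component (tuple qs) n) ,
                _⇉_.resp (multi (δ target)) (λ k → sym (component-tuple qs n k))
                  (Setoid.refl (space target)) (proj₁ (proj₂ (proj₂ (proj₂ (r n)))))) ,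
         g , 0 , y 0 , Setoid.refl (space (completion target)) ,
         proj₂ (proj₂ (proj₂ (proj₂ (r 0))))
  }
  where
  open Problem f
  F        = proj₁ realizable
  realizes = proj₂ realizable

data Reducibility : Set where
  sW W sW* W* : Reducibility

StronglyReducible WeaklyReducible : (Baire ⇀ Baire → Set) → Problem → Problem → Set₁
StronglyReducible C f g = ∃₂ λ H K → C H × C K ×
  (∀ G → G Realizes g → (H ∘⇀ G ∘⇀ K) Realizes f)
WeaklyReducible C f g = ∃₂ λ H K → C H × C K ×
  (∀ G → G Realizes g → (H ∘⇀ ⟨id, G ∘⇀ K ⟩) Realizes f)

infix 4 _≤[_]_ _≡[_]_

_≤[_]_ : Problem → Reducibility → Problem → Set₁
f ≤[ sW  ] g = StronglyReducible Computable f g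
f ≤[ W   ] g = WeaklyReducible   Computable f g
f ≤[ sW* ] g = StronglyReducible Continuous f g
f ≤[ W*  ] g = WeaklyReducible   Continuous f g

_≡[_]_ : Problem → Reducibility → Problem → Set₁
f ≡[ r ] g = f ≤[ r ] g × g ≤[ r ] f

{-# OPTIONS --safe #-}

-- Parallelization is a closure operator (f ≤ Πf ≡ ΠΠf, monotone), stashing is an interior
-- operator (ΣΣf ≡ Σf ≤ f, monotone), and ΠΣf ≤ ΣΠf by transposing a double sequence.  Hence
-- ΠΣΠf ≤ ΣΠΠf ≤ ΣΠf and ΠΣf ≤ ΠΣΣf ≤ ΣΠΣf, and each equivalence is a short chain of reductions;
-- for example f ≤ ΣΠf gives Πf ≤ ΠΣΠf ≤ ΣΠf ≤ Πf.
--
-- Monotonicity of Σ needs, for a computable or continuous partial H, a total Ĥ in the same class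
-- acting on names of completed spaces: Ĥ emits the letters of H(p - 1) as soon as they are
-- determined by the finite part of p - 1 seen so far, and zeros meanwhile.  For computable H this
-- uses a step-bounded evaluation of codes, for continuous H excluded middle decides whether a
-- finite word determines a letter.

module Submission where

open import Defs
open import Axiom.ExcludedMiddle using (ExcludedMiddle)
open import Data.Fin using (Fin; zero; suc; _↑ʳ_)
open import Data.Fin.Patterns using (0F; 1F; 2F)
open import Data.List using (List; []; _∷_; _++_; length; concatMap; applyUpTo)
open import Data.List.Properties using (length-++; ++-identityʳ; concatMap-++)
open import Data.Maybe using (just)
import Data.Maybe.Relation.Binary.Pointwise as Maybe
open import Data.Nat
  using (ℕ; zero; suc; pred; _+_; _*_; _∸_; _≤_; _<_; _⊔_; z≤n; s≤s)
open import Data.Nat.DivMod using (_/_)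
open import Data.Nat.Properties
open import Data.Product using (∃; ∃₂; _×_; _,_; proj₁; proj₂)
open import Data.Product.Function.NonDependent.Propositional using (_×-⇔_)
open import Data.Sum using (_⊎_; inj₁; inj₂; [_,_]′)
open import Data.Vec using (Vec; []; _∷_; lookup; tabulate)
import Data.Vec as Vec
open import Data.Vec.Relation.Binary.Pointwise.Inductive using (Pointwise; []; _∷_)
open import Function using (_∘_)
open import Function.Bundles using (_⇔_; mk⇔)
open import Function.Properties.Equivalence using () renaming (sym to ⇔-sym; trans to ⇔-trans)
open import Level using (0ℓ)
open import Relation.Binary using (Setoid; tri<; tri≈; tri>)
open import Relation.Binary.PropositionalEquality
  using (_≡_; refl; sym; trans; cong; cong₂; subst; _≗_; module ≡-Reasoning)
open import Relation.Nullary using (¬_; contradiction; yes; no)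

open _⇀_ using (multi)

-- A solution of `Σ g` is correct at one unknown place and arbitrary elsewhere, yet an output is due
-- at every place: hence `H` must be made total before `Σ` can be shown monotone. The arbitrary
-- outputs do no harm, since every sequence names some element of a completion. The reducibilities
-- quantify over realizers, which is a second obstacle: a realizer of `Π g` or `Σ g` treats a whole
-- sequence at once, and its separate components need not come from one realizer of `g`. Reductions
-- are therefore restated for single names of instances and solutions; under excluded middle this is
-- equivalent. Transposition works because one correct column of a double sequence contributes a
-- correct entry to each row.

private variable
  m n : ℕ

-- Oracle computations

⇓-deterministic : ∀ {p} {c : Code n} {xs y z} → p ⊢ c [ xs ]⇓ y → p ⊢ c [ xs ]⇓ z → y ≡ z
⇓*-deterministic : ∀ {p} {cs : Vec (Code n) m} {xs ys zs} →
  Pointwise (λ c y → p ⊢ c [ xs ]⇓ y) cs ys → Pointwise (λ c z → p ⊢ c [ xs ]⇓ z) cs zs → ys ≡ zs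
⇓-deterministic zero⇓         zero⇓           = refl
⇓-deterministic suc⇓          suc⇓            = refl
⇓-deterministic (proj⇓ i)     (proj⇓ .i)      = refl
⇓-deterministic oracle⇓       oracle⇓         = refl
⇓-deterministic (comp⇓ ds c)  (comp⇓ ds′ c′)  with refl ← ⇓*-deterministic ds ds′ = ⇓-deterministic c c′
⇓-deterministic (prec-z⇓ c)   (prec-z⇓ c′)    = ⇓-deterministic c c′
⇓-deterministic (prec-s⇓ c d) (prec-s⇓ c′ d′) with refl ← ⇓-deterministic c c′ = ⇓-deterministic d d′
⇓-deterministic (μ⇓ {y = y} c below) (μ⇓ {y = z} c′ below′) with <-cmp y z
... | tri≈ _ y≡z _ = y≡z
... | tri< y<z _ _ with () ← ⇓-deterministic c (proj₂ (below′ y y<z))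
... | tri> _ _ z<y with () ← ⇓-deterministic c′ (proj₂ (below z z<y))
⇓*-deterministic []       []         = refl
⇓*-deterministic (d ∷ ds) (d′ ∷ ds′) = cong₂ _∷_ (⇓-deterministic d d′) (⇓*-deterministic ds ds′)

-- Moduli and stages are found below for one index at a time; upward closure lets a maximum serve
-- finitely many indices together.
bounded-max : (P : ℕ → ℕ → Set) → (∀ {x i j} → i ≤ j → P x i → P x j) →
              ∀ n → (∀ x → x < n → ∃ (P x)) → ∃ λ b → ∀ x → x < n → P x b
bounded-max P mono zero    each = 0 , λ _ ()
bounded-max P mono (suc n) each =
  let b , P-b = bounded-max P mono n λ x x<n → each x (m≤n⇒m≤1+n x<n)
      c , P-c = each n ≤-refl
  in b ⊔ c , λ x x≤n →
       [ mono (m≤m⊔n b c) ∘ P-b x , (λ { refl → mono (m≤n⊔m b c) P-c }) ]′ (m≤n⇒m<n∨m≡n (≤-pred x≤n))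

≗[]-weaken : ∀ {p q i j} → i ≤ j → p ≗[ j ] q → p ≗[ i ] q
≗[]-weaken i≤j e k k<i = e k (<-≤-trans k<i i≤j)

-- A halting computation makes only finitely many oracle queries. This yields the continuity of
-- computable functions and also invariance under `≗`, which needs proof since pointwise equal
-- oracles are not identical.
⇓-use : ∀ {p} {c : Code n} {xs y} → p ⊢ c [ xs ]⇓ y →
        ∃ λ b → ∀ q → p ≗[ b ] q → q ⊢ c [ xs ]⇓ y
⇓*-use : ∀ {p} {cs : Vec (Code n) m} {xs ys} → Pointwise (λ c y → p ⊢ c [ xs ]⇓ y) cs ys →
         ∃ λ b → ∀ q → p ≗[ b ] q → Pointwise (λ c y → q ⊢ c [ xs ]⇓ y) cs ys
⇓-use zero⇓         = 0 , λ _ _ → zero⇓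
⇓-use suc⇓          = 0 , λ _ _ → suc⇓
⇓-use (proj⇓ i)     = 0 , λ _ _ → proj⇓ i
⇓-use (oracle⇓ {x}) = suc x , λ q e → subst (q ⊢ oracle [ x ∷ [] ]⇓_) (sym (e x ≤-refl)) oracle⇓
⇓-use (comp⇓ ds c)  =
  let b , f = ⇓*-use ds ; b′ , g = ⇓-use c
  in b ⊔ b′ , λ q e → comp⇓ (f q (≗[]-weaken (m≤m⊔n b b′) e)) (g q (≗[]-weaken (m≤n⊔m b b′) e))
⇓-use (prec-z⇓ c)   = let b , f = ⇓-use c in b , λ q e → prec-z⇓ (f q e)
⇓-use (prec-s⇓ c d) =
  let b , f = ⇓-use c ; b′ , g = ⇓-use d
  in b ⊔ b′ , λ q e → prec-s⇓ (f q (≗[]-weaken (m≤m⊔n b b′) e)) (g q (≗[]-weaken (m≤n⊔m b b′) e))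
⇓-use {p = p} (μ⇓ {c = c} {xs} {y} found below) =
  let b , f = ⇓-use found
      b′ , g = bounded-max
        (λ x b → ∀ q → p ≗[ b ] q → ∃ λ v → q ⊢ c [ x ∷ xs ]⇓ suc v)
        (λ i≤j h q e → h q (≗[]-weaken i≤j e)) y
        (λ x x<y → uses (proj₂ (below x x<y)))
  in b ⊔ b′ , λ q e → μ⇓ (f q (≗[]-weaken (m≤m⊔n b b′) e))
                         (λ x x<y → g x x<y q (≗[]-weaken (m≤n⊔m b b′) e))
  where
  uses : ∀ {x v} → p ⊢ c [ x ∷ xs ]⇓ suc v →
         ∃ λ b → ∀ q → p ≗[ b ] q → ∃ λ v → q ⊢ c [ x ∷ xs ]⇓ suc v
  uses {v = v} h = let b , f = ⇓-use h in b , λ q e → v , f q e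
⇓*-use []       = 0 , λ _ _ → []
⇓*-use (d ∷ ds) =
  let b , f = ⇓-use d ; b′ , g = ⇓*-use ds
  in b ⊔ b′ , λ q e → f q (≗[]-weaken (m≤m⊔n b b′) e) ∷ g q (≗[]-weaken (m≤n⊔m b b′) e)

⇓-resp-≗ : ∀ {p q} {c : Code n} {xs y} → p ≗ q → p ⊢ c [ xs ]⇓ y → q ⊢ c [ xs ]⇓ y
⇓-resp-≗ e h = proj₂ (⇓-use h) _ λ i _ → e i

⟦_⟧ : Code 1 → Baire ⇀ Baire
⟦ c ⟧ = record
  { multi = record
    { Graph = λ p q → ∀ n → p ⊢ c [ n ∷ [] ]⇓ q n
    ; resp  = λ {p} {p′} p≗ q≗ h n → subst (p′ ⊢ c [ n ∷ [] ]⇓_) (q≗ n) (⇓-resp-≗ p≗ (h n))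
    }
  ; singleValued = λ h h′ n → ⇓-deterministic (h n) (h′ n)
  }

⟦⟧-computable : ∀ c → Computable ⟦ c ⟧
⟦⟧-computable c = c , λ _ _ h → h

-- The maximum of the moduli of the first n output places is a modulus for the prefix of length n.
pointwise⇒Continuous : ∀ F →
  (∀ p q → F ∋ p ↦ q → ∀ i → ∃ λ b → ∀ p′ q′ → F ∋ p′ ↦ q′ → p ≗[ b ] p′ → q i ≡ q′ i) →
  Continuous F
pointwise⇒Continuous F pw p q h n =
  let b , f = bounded-max (λ i b → ∀ p′ q′ → F ∋ p′ ↦ q′ → p ≗[ b ] p′ → q i ≡ q′ i)
                (λ i≤j g p′ q′ h′ e → g p′ q′ h′ (≗[]-weaken i≤j e)) n (λ i _ → pw p q h i)
  in b , λ p′ q′ h′ e i i<n → f i i<n p′ q′ h′ e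

Computable⇒Continuous : ∀ {F} → Computable F → Continuous F
Computable⇒Continuous {F} (c , computes) = pointwise⇒Continuous F λ p q h i →
  let b , f = ⇓-use (computes p q h i)
  in b , λ p′ q′ h′ e → ⇓-deterministic (f p′ e) (computes p′ q′ h′ i)

projections⇓ : ∀ {p zs} (f : Fin n → Fin m) (xs : Vec ℕ n) → (∀ i → lookup zs (f i) ≡ lookup xs i) →
               Pointwise (λ d y → p ⊢ d [ zs ]⇓ y) (tabulate (proj ∘ f)) xs
projections⇓           f []       e = []
projections⇓ {p = p} {zs} f (x ∷ xs) e =
  subst (p ⊢ proj (f 0F) [ zs ]⇓_) (e 0F) (proj⇓ (f 0F)) ∷ projections⇓ (f ∘ suc) xs (e ∘ suc)

-- relativize d c runs c with the oracle x ↦ d(a,x), where a is an additional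
-- first argument.
relativize  : Code 2 → Code n → Code (suc n)
relativize* : Code 2 → Vec (Code n) m → Vec (Code (suc n)) m
relativize d zero        = zero
relativize d suc         = comp suc (proj 1F ∷ [])
relativize d (proj i)    = proj (suc i)
relativize d oracle      = d
relativize d (comp c cs) = comp (relativize d c) (proj 0F ∷ relativize* d cs)
relativize d (prec b c)  =
  comp (prec (relativize d b)
             (comp (relativize d c)
                   (proj 2F ∷ proj 0F ∷ proj 1F ∷ tabulate (proj ∘ (3 ↑ʳ_)))))
       (proj 1F ∷ proj 0F ∷ tabulate (proj ∘ (2 ↑ʳ_)))
relativize d (μ c)       =
  μ (comp (relativize d c) (proj 1F ∷ proj 0F ∷ tabulate (proj ∘ (2 ↑ʳ_))))
relativize* d []       = []
relativize* d (c ∷ cs) = relativize d c ∷ relativize* d cs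

module _ {p q : ℕ^ℕ} {d : Code 2} {a : ℕ} (simulates : ∀ x → p ⊢ d [ a ∷ x ∷ [] ]⇓ q x) where

  relativize⇓  : ∀ {c : Code n} {xs y} → q ⊢ c [ xs ]⇓ y → p ⊢ relativize d c [ a ∷ xs ]⇓ y
  relativize*⇓ : ∀ {cs : Vec (Code n) m} {xs ys} → Pointwise (λ c y → q ⊢ c [ xs ]⇓ y) cs ys →
                 Pointwise (λ c y → p ⊢ c [ a ∷ xs ]⇓ y) (relativize* d cs) ys
  -- `prec` recurses on its first argument, so the parameter `a` has to move behind `x`. The
  -- induction runs on this reordered recursion, before the outer `comp` restores the order.
  precursion⇓  : ∀ {b : Code n} {c x xs y} → q ⊢ prec b c [ x ∷ xs ]⇓ y →
    p ⊢ prec (relativize d b)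
             (comp (relativize d c)
                   (proj 2F ∷ proj 0F ∷ proj 1F ∷ tabulate (proj ∘ (3 ↑ʳ_))))
      [ x ∷ a ∷ xs ]⇓ y
  relativize⇓ zero⇓              = zero⇓
  relativize⇓ suc⇓               = comp⇓ (proj⇓ 1F ∷ []) suc⇓
  relativize⇓ (proj⇓ i)          = proj⇓ (suc i)
  relativize⇓ (oracle⇓ {x})      = simulates x
  relativize⇓ (comp⇓ cs c)       = comp⇓ (proj⇓ 0F ∷ relativize*⇓ cs) (relativize⇓ c)
  relativize⇓ h@(prec-z⇓ _)      =
    comp⇓ (proj⇓ 1F ∷ proj⇓ 0F ∷ projections⇓ (2 ↑ʳ_) _ λ _ → refl) (precursion⇓ h)
  relativize⇓ h@(prec-s⇓ _ _)    =
    comp⇓ (proj⇓ 1F ∷ proj⇓ 0F ∷ projections⇓ (2 ↑ʳ_) _ λ _ → refl) (precursion⇓ h)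
  relativize⇓ (μ⇓ found below)   =
    μ⇓ (comp⇓ (proj⇓ 1F ∷ proj⇓ 0F ∷ projections⇓ (2 ↑ʳ_) _ λ _ → refl) (relativize⇓ found))
       (λ x x<y → let v , h = below x x<y in
          v , comp⇓ (proj⇓ 1F ∷ proj⇓ 0F ∷ projections⇓ (2 ↑ʳ_) _ λ _ → refl) (relativize⇓ h))
  relativize*⇓ []       = []
  relativize*⇓ (h ∷ hs) = relativize⇓ h ∷ relativize*⇓ hs
  precursion⇓ (prec-z⇓ h)    = prec-z⇓ (relativize⇓ h)
  precursion⇓ (prec-s⇓ h h′) = prec-s⇓ (precursion⇓ h)
    (comp⇓ (proj⇓ 2F ∷ proj⇓ 0F ∷ proj⇓ 1F ∷ projections⇓ (3 ↑ʳ_) _ λ _ → refl) (relativize⇓ h′))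

∘-computable : ∀ {F G} → Computable F → Computable G → Computable (F ∘⇀ G)
∘-computable (c , computes-F) (d , computes-G) =
  -- The simulated oracle is the same for every parameter, so zero fills that slot.
  comp (relativize (comp d (proj 1F ∷ [])) c) (zero ∷ proj 0F ∷ []) ,
  λ p r (q , g , f) n →
    comp⇓ (zero⇓ ∷ proj⇓ 0F ∷ [])
      (relativize⇓ (λ x → comp⇓ (proj⇓ 1F ∷ []) (computes-G p q g x)) (computes-F q r f n))

∘-continuous : ∀ {F G} → Continuous F → Continuous G → Continuous (F ∘⇀ G)
∘-continuous cont-F cont-G p r (q , g , f) n =
  let b , F≗ = cont-F q r f n ; b′ , G≗ = cont-G p q g b
  in b′ , λ p′ r′ (q′ , g′ , f′) e → F≗ q′ r′ f′ (G≗ p′ q′ g′ e)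

-- Total computable functionals

-- Bundling a code with its value as an Agda function lets programs be built by combinators and
-- verified by equations about `eval` instead of derivations.
record Total (n : ℕ) : Set where
  field
    code    : Code n
    eval    : ℕ^ℕ → Vec ℕ n → ℕ
    correct : ∀ p xs → p ⊢ code [ xs ]⇓ eval p xs

open Total

evalAll : Vec (Total n) m → ℕ^ℕ → Vec ℕ n → Vec ℕ m
evalAll []       p xs = []
evalAll (f ∷ fs) p xs = eval f p xs ∷ evalAll fs p xs

infixr 9 _∙_

_∙_ : Total m → Vec (Total n) m → Total n
f ∙ gs = record
  { code    = comp (code f) (Vec.map code gs)
  ; eval    = λ p xs → eval f p (evalAll gs p xs)
  ; correct = λ p xs → comp⇓ (all gs p xs) (correct f p (evalAll gs p xs))
  }
  where
  all : ∀ {k} (gs : Vec (Total _) k) p xs → Pointwise (λ c y → p ⊢ c [ xs ]⇓ y) (Vec.map code gs) (evalAll gs p xs)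
  all []       p xs = []
  all (g ∷ gs) p xs = correct g p xs ∷ all gs p xs

recurse : ℕ → (ℕ → ℕ → ℕ) → ℕ → ℕ
recurse a f zero    = a
recurse a f (suc x) = f x (recurse a f x)

primrec : Total n → Total (2 + n) → Total (suc n)
primrec f g = record
  { code    = prec (code f) (code g)
  ; eval    = λ { p (x ∷ xs) → recurse (eval f p xs) (λ x y → eval g p (x ∷ y ∷ xs)) x }
  ; correct = λ { p (x ∷ xs) → go p x xs }
  }
  where
  go : ∀ p x xs → p ⊢ prec (code f) (code g) [ x ∷ xs ]⇓
                  recurse (eval f p xs) (λ x y → eval g p (x ∷ y ∷ xs)) x
  go p zero    xs = prec-z⇓ (correct f p xs)
  go p (suc x) xs = prec-s⇓ (go p x xs) (correct g p _)

-- Replaces the nested recursors produced by the combinators with the intended function, so that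
-- later goals mention only the latter.
restate : (f : Total n) (F : ℕ^ℕ → Vec ℕ n → ℕ) → (∀ p xs → eval f p xs ≡ F p xs) → Total n
restate f F eq = record
  { code = code f ; eval = F ; correct = λ p xs → subst (p ⊢ code f [ xs ]⇓_) (eq p xs) (correct f p xs) }

var : Fin n → Total n
var i = record { code = proj i ; eval = λ _ xs → lookup xs i ; correct = λ _ _ → proj⇓ i }

evalAll-vars : ∀ {p zs} (f : Fin n → Fin m) (xs : Vec ℕ n) →
               (∀ i → lookup zs (f i) ≡ lookup xs i) → evalAll (tabulate (var ∘ f)) p zs ≡ xs
evalAll-vars f []       e = refl
evalAll-vars f (x ∷ xs) e = cong₂ _∷_ (e 0F) (evalAll-vars (f ∘ suc) xs (e ∘ suc))

zeroᵀ : Total n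
zeroᵀ = record { code = zero ; eval = λ _ _ → 0 ; correct = λ _ _ → zero⇓ }

sucᵀ oracleᵀ : Total 1
sucᵀ    = record { code = suc ; eval = λ { _ (x ∷ []) → suc x } ; correct = λ { _ (_ ∷ []) → suc⇓ } }
oracleᵀ = record { code = oracle ; eval = λ { p (x ∷ []) → p x } ; correct = λ { _ (_ ∷ []) → oracle⇓ } }

oneᵀ : Total n
oneᵀ = sucᵀ ∙ (zeroᵀ ∷ [])

ifZero : ℕ → ℕ → ℕ → ℕ
ifZero zero    a b = a
ifZero (suc _) a b = b

ifZeroᵀ : Total 3
ifZeroᵀ = restate (primrec (var 0F) (var (3 ↑ʳ 0F))) (λ { _ (x ∷ a ∷ b ∷ []) → ifZero x a b })
  λ { _ (zero ∷ _ ∷ _ ∷ []) → refl ; _ (suc _ ∷ _ ∷ _ ∷ []) → refl }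

predᵀ : Total 1
predᵀ = restate (primrec zeroᵀ (var 0F)) (λ { _ (x ∷ []) → pred x })
  λ { _ (zero ∷ []) → refl ; _ (suc _ ∷ []) → refl }

addᵀ : Total 2
addᵀ = restate (primrec (var 0F) (sucᵀ ∙ (var 1F ∷ []))) (λ { _ (x ∷ y ∷ []) → x + y })
  λ { _ (x ∷ y ∷ []) → eq x y }
  where
  eq : ∀ x y → recurse y (λ _ r → suc r) x ≡ x + y
  eq zero    y = refl
  eq (suc x) y = cong suc (eq x y)

monusᵀ : Total 2
monusᵀ = restate (primrec (var 0F) (predᵀ ∙ (var 1F ∷ [])) ∙ (var 1F ∷ var 0F ∷ []))
  (λ { _ (x ∷ y ∷ []) → x ∸ y }) λ { _ (x ∷ y ∷ []) → eq x y }
  where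
  eq : ∀ x y → recurse x (λ _ r → pred r) y ≡ x ∸ y
  eq x zero    = refl
  eq x (suc y) = trans (cong pred (eq x y)) (pred[m∸n]≡m∸[1+n] x y)

doubleᵀ : Total 1
doubleᵀ = restate (addᵀ ∙ (var 0F ∷ addᵀ ∙ (var 0F ∷ zeroᵀ ∷ []) ∷ [])) (λ { _ (x ∷ []) → 2 * x })
  λ { _ (_ ∷ []) → refl }

triangle : ℕ → ℕ
triangle zero    = 0
triangle (suc s) = suc s + triangle s

triangleᵀ : Total 1
triangleᵀ = restate (primrec zeroᵀ (sucᵀ ∙ (addᵀ ∙ (var 0F ∷ var 1F ∷ []) ∷ [])))
  (λ { _ (s ∷ []) → triangle s }) λ { _ (s ∷ []) → eq s }
  where
  eq : ∀ s → recurse 0 (λ s r → suc (s + r)) s ≡ triangle s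
  eq zero    = refl
  eq (suc s) = cong (λ r → suc (s + r)) (eq s)

-- `pair-turn` is already the induction step: up to added zeros, the left side at `suc s` is
-- `pair (suc s) 0`. This removes the division from `pair`.
halved-product≡triangle : ∀ s → s * (s + 1) / 2 ≡ triangle s
halved-product≡triangle zero    = refl
halved-product≡triangle (suc s) = begin
  suc s * (suc s + 1) / 2           ≡⟨ cong (λ t → t * (t + 1) / 2) (+-identityʳ (suc s)) ⟨
  (suc s + 0) * (suc s + 0 + 1) / 2 ≡⟨ +-identityʳ _ ⟨
  pair (suc s) 0                    ≡⟨ pair-turn s ⟩
  suc (s * (s + 1) / 2 + s)         ≡⟨ cong (λ t → suc (t + s)) (halved-product≡triangle s) ⟩
  suc (triangle s + s)              ≡⟨ cong suc (+-comm (triangle s) s) ⟩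
  triangle (suc s)                  ∎
  where open ≡-Reasoning

pairᵀ : Total 2
pairᵀ = restate
  (addᵀ ∙ (triangleᵀ ∙ (addᵀ ∙ (var 0F ∷ var 1F ∷ []) ∷ []) ∷ var 1F ∷ []))
  (λ { _ (n ∷ k ∷ []) → pair n k })
  λ { _ (n ∷ k ∷ []) → sym (cong (_+ k) (halved-product≡triangle (n + k))) }

-- n + k for the pair (n , k) coded by m: it increases at m + 1 iff m ends a diagonal.
diagonalᵀ : Total 1
diagonalᵀ = primrec zeroᵀ
  (ifZeroᵀ ∙ (monusᵀ ∙ (addᵀ ∙ (triangleᵀ ∙ (var 1F ∷ []) ∷ var 1F ∷ []) ∷ var 0F ∷ [])
              ∷ sucᵀ ∙ (var 1F ∷ []) ∷ var 1F ∷ []))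

-- The second equation shows that the difference tested by `diagonalᵀ` is the first coordinate,
-- which vanishes exactly at the end of a diagonal. The two equations therefore have to be proved
-- together.
diagonal-unpair : ∀ p m → let n , k = unpair m in
  eval diagonalᵀ p (m ∷ []) ≡ n + k × m ≡ triangle (n + k) + k
diagonal-unpair p zero    = refl , refl
diagonal-unpair p (suc m) with unpair m | diagonal-unpair p m
... | zero  , k | d , e rewrite d | sym e | n∸n≡0 m =
  cong suc (sym (+-identityʳ k)) , (begin
    suc m                             ≡⟨ cong suc e ⟩
    suc (triangle k + k)              ≡⟨ cong suc (+-comm (triangle k) k) ⟩
    triangle (suc k)                  ≡⟨ cong (triangle ∘ suc) (+-identityʳ k) ⟨
    triangle (suc k + 0)              ≡⟨ +-identityʳ _ ⟨
    triangle (suc k + 0) + 0          ∎)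
  where open ≡-Reasoning
... | suc n , k | d , e =
  trans (cong₂ (λ D M → ifZero (triangle D + D ∸ M) (suc D) D) d e)
        (trans (cong (λ x → ifZero x (suc (suc n + k)) (suc n + k)) remaining) (sym (+-suc n k))) ,
  trans (cong suc e) (trans (sym (+-suc _ k)) (cong (λ s → triangle s + suc k) (sym (+-suc n k))))
  where
  remaining : triangle (suc n + k) + (suc n + k) ∸ (triangle (suc n + k) + k) ≡ suc n
  remaining = trans ([m+n]∸[m+o]≡n∸o (triangle (suc n + k)) (suc n + k) k) (m+n∸n≡m (suc n) k)

sndᵀ fstᵀ : Total 1
sndᵀ = restate (monusᵀ ∙ (var 0F ∷ triangleᵀ ∙ (diagonalᵀ ∷ []) ∷ []))
  (λ { _ (m ∷ []) → proj₂ (unpair m) }) λ { p (m ∷ []) → eq p m }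
  where
  eq : ∀ p m → m ∸ triangle (eval diagonalᵀ p (m ∷ [])) ≡ proj₂ (unpair m)
  eq p m with d , e ← diagonal-unpair p m =
    trans (cong₂ (λ M D → M ∸ triangle D) e d) (m+n∸m≡n (triangle (proj₁ (unpair m) + proj₂ (unpair m))) _)
fstᵀ = restate (monusᵀ ∙ (diagonalᵀ ∷ sndᵀ ∷ []))
  (λ { _ (m ∷ []) → proj₁ (unpair m) }) λ { p (m ∷ []) → eq p m }
  where
  eq : ∀ p m → eval diagonalᵀ p (m ∷ []) ∸ proj₂ (unpair m) ≡ proj₁ (unpair m)
  eq p m = trans (cong (_∸ proj₂ (unpair m)) (proj₁ (diagonal-unpair p m)))
                 (m+n∸n≡m _ (proj₂ (unpair m)))

parity half : ℕ → ℕ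
parity zero    = 0
parity (suc m) = ifZero (parity m) 1 0
half zero    = 0
half (suc m) = ifZero (parity m) (half m) (suc (half m))

-- At a successor `⟨_,_⟩` swaps its arguments and shifts one of them. The induction hypothesis is
-- therefore taken at `q` and `p ∘ suc`, and `half` grows only after an odd position.
⟨,⟩-parity : ∀ p q m → ⟨ p , q ⟩ m ≡ ifZero (parity m) (p (half m)) (q (half m))
⟨,⟩-parity p q zero = refl
⟨,⟩-parity p q (suc m) with parity m | half m | ⟨,⟩-parity q (p ∘ suc) m
... | zero  | _ | e = e
... | suc _ | _ | e = e

parityᵀ halfᵀ : Total 1
parityᵀ = restate (primrec zeroᵀ (ifZeroᵀ ∙ (var 1F ∷ oneᵀ ∷ zeroᵀ ∷ [])))
  (λ { _ (m ∷ []) → parity m }) λ { _ (m ∷ []) → eq m }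
  where
  eq : ∀ m → recurse 0 (λ _ r → ifZero r 1 0) m ≡ parity m
  eq zero    = refl
  eq (suc m) = cong (λ r → ifZero r 1 0) (eq m)
halfᵀ = restate
  (primrec zeroᵀ (ifZeroᵀ ∙ (parityᵀ ∙ (var 0F ∷ []) ∷ var 1F ∷ sucᵀ ∙ (var 1F ∷ []) ∷ [])))
  (λ { _ (m ∷ []) → half m }) λ { _ (m ∷ []) → eq m }
  where
  eq : ∀ m → recurse 0 (λ m r → ifZero (parity m) r (suc r)) m ≡ half m
  eq zero    = refl
  eq (suc m) = cong (λ r → ifZero (parity m) r (suc r)) (eq m)

functional : Total 1 → ℕ^ℕ → ℕ^ℕ
functional f p n = eval f p (n ∷ [])

⟦⟧-functional : ∀ f p → ⟦ code f ⟧ ∋ p ↦ functional f p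
⟦⟧-functional f p n = correct f p (n ∷ [])

-- Pairing and parallel application of functionals

⟨_,_⟩⇀ : Baire ⇀ Baire → Baire ⇀ Baire → Baire ⇀ Baire
⟨ F , G ⟩⇀ = record
  { multi = record
    { Graph = λ p r → ∃₂ λ q q′ → (F ∋ p ↦ q) × (G ∋ p ↦ q′) × r ≗ ⟨ q , q′ ⟩
    ; resp  = λ p≗ r≗ (q , q′ , f , g , e) →
        q , q′ , _⇉_.resp (multi F) p≗ (λ _ → refl) f , _⇉_.resp (multi G) p≗ (λ _ → refl) g
          , λ i → trans (sym (r≗ i)) (e i)
    }
  ; singleValued = λ (_ , _ , f , g , e) (_ , _ , f′ , g′ , e′) i →
      trans (e i)
        (trans (⟨,⟩-cong (_⇀_.singleValued F f f′) (_⇀_.singleValued G g g′) i) (sym (e′ i)))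
  }

⟨,⟩⇀-computable : ∀ {F G} → Computable F → Computable G → Computable ⟨ F , G ⟩⇀
⟨,⟩⇀-computable (c , computes-F) (d , computes-G) =
  comp (code ifZeroᵀ)
    (code parityᵀ ∷ comp c (code halfᵀ ∷ []) ∷ comp d (code halfᵀ ∷ []) ∷ []) ,
  λ p r (q , q′ , f , g , e) n → subst (p ⊢ _ [ n ∷ [] ]⇓_)
    (trans (sym (⟨,⟩-parity q q′ n)) (sym (e n)))
    (comp⇓ (correct parityᵀ p _
            ∷ comp⇓ (correct halfᵀ p _ ∷ []) (computes-F p q f _)
            ∷ comp⇓ (correct halfᵀ p _ ∷ []) (computes-G p q′ g _) ∷ [])
           (correct ifZeroᵀ p _))

⟨,⟩⇀-continuous : ∀ {F G} → Continuous F → Continuous G → Continuous ⟨ F , G ⟩⇀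
⟨,⟩⇀-continuous {F} {G} cont-F cont-G =
  pointwise⇒Continuous ⟨ F , G ⟩⇀ λ p r (q , s , f , g , e) i →
    let b , F≗ = cont-F p q f (suc (half i)) ; b′ , G≗ = cont-G p s g (suc (half i))
    in b ⊔ b′ , λ p′ r′ (q′ , s′ , f′ , g′ , e′) p≗ →
      trans (e i) (trans (⟨,⟩-parity q s i) (trans
        (cong₂ (ifZero (parity i))
          (F≗ p′ q′ f′ (≗[]-weaken (m≤m⊔n b b′) p≗) (half i) ≤-refl)
          (G≗ p′ s′ g′ (≗[]-weaken (m≤n⊔m b b′) p≗) (half i) ≤-refl))
        (trans (sym (⟨,⟩-parity q′ s′ i)) (sym (e′ i)))))

parallel : Baire ⇀ Baire → Baire ⇀ Baire
parallel = componentwise (λ a → a)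

-- One code serves all components: the component index, decoded from the output position, is the
-- parameter of the simulated oracle.
parallel-computable : ∀ {F} → Computable F → Computable (parallel F)
parallel-computable (c , computes) =
  comp (relativize (code componentᵀ) c) (code fstᵀ ∷ code sndᵀ ∷ []) ,
  λ p r (qs , f , e) n → subst (p ⊢ _ [ n ∷ [] ]⇓_) (sym (e n))
    (comp⇓ (correct fstᵀ p _ ∷ correct sndᵀ p _ ∷ [])
      (relativize⇓ (λ k → correct componentᵀ p _) (computes _ _ (f _) _)))
  where
  componentᵀ : Total 2
  componentᵀ = restate (oracleᵀ ∙ (pairᵀ ∷ [])) (λ { p (n ∷ k ∷ []) → component p n k })
    λ { _ (_ ∷ _ ∷ []) → refl }

parallel-continuous : ∀ {F} → Continuous F → Continuous (parallel F)
parallel-continuous {F} cont = pointwise⇒Continuous (parallel F) λ p r (qs , f , e) i →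
  let n , k = unpair i
      b , F≗ = cont (component p n) (qs n) (f n) (suc k)
      -- The modulus b counts positions inside component n; B bounds the places `pair n j` where
      -- these lie in p.
      B , pair<B = bounded-max (λ j B → pair n j < B) (λ i≤j lt → <-≤-trans lt i≤j) b
                     (λ j _ → suc (pair n j) , ≤-refl)
  in B , λ p′ r′ (qs′ , f′ , e′) p≗ →
    trans (e i) (trans
      (F≗ (component p′ n) (qs′ n) (f′ n) (λ j j<b → p≗ (pair n j) (pair<B j j<b)) k ≤-refl)
      (sym (e′ i)))

-- Completed names

-- Partial values are coded by 0 for undefined and suc v for v, as in the completion.

nth : List ℕ → ℕ → ℕ
nth []      i       = 0
nth (x ∷ w) zero    = suc x
nth (x ∷ w) (suc i) = nth w i

-- If `w` has no letter at i, then its length is at most i, so the truncated difference is zero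
-- exactly at the place where a new letter would go. Read as a partial value, `letter-1 a` is a
-- itself.
nth-++-letter : ∀ w a i →
  nth (w ++ letter-1 a) i ≡ ifZero (nth w i) (ifZero (i ∸ length w) a 0) (nth w i)
nth-++-letter []      zero    zero    = refl
nth-++-letter []      zero    (suc i) = refl
nth-++-letter []      (suc a) zero    = refl
nth-++-letter []      (suc a) (suc i) = refl
nth-++-letter (x ∷ w) a       zero    = refl
nth-++-letter (x ∷ w) a       (suc i) = nth-++-letter w a i

nth-applyUpTo : ∀ q {k i} → i < k → nth (applyUpTo q k) i ≡ suc (q i)
nth-applyUpTo q {i = zero}  (s≤s i<k) = refl
nth-applyUpTo q {i = suc i} (s≤s i<k) = nth-applyUpTo (q ∘ suc) i<k

applyUpTo-snoc : ∀ (q : ℕ^ℕ) k → applyUpTo q (suc k) ≡ applyUpTo q k ++ q k ∷ []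
applyUpTo-snoc q zero    = refl
applyUpTo-snoc q (suc k) = cong (q 0 ∷_) (applyUpTo-snoc (q ∘ suc) k)

word-1-snoc : ∀ p t → word-1 p (suc t) ≡ word-1 p t ++ letter-1 (p t)
word-1-snoc p t = begin
  concatMap letter-1 (applyUpTo p (suc t))          ≡⟨ cong (concatMap letter-1) (applyUpTo-snoc p t) ⟩
  concatMap letter-1 (applyUpTo p t ++ p t ∷ [])    ≡⟨ concatMap-++ letter-1 (applyUpTo p t) _ ⟩
  word-1 p t ++ (letter-1 (p t) ++ [])              ≡⟨ cong (word-1 p t ++_) (++-identityʳ _) ⟩
  word-1 p t ++ letter-1 (p t)                      ∎
  where open ≡-Reasoning

letter : ℕ^ℕ → ℕ → ℕ → ℕ
letter p t = nth (word-1 p t)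

letter-step : ∀ p t i →
  letter p (suc t) i ≡ ifZero (letter p t i) (ifZero (i ∸ length (word-1 p t)) (p t) 0) (letter p t i)
letter-step p t i = trans (cong (λ w → nth w i) (word-1-snoc p t)) (nth-++-letter (word-1 p t) (p t) i)

letter-persists : ∀ p {s t i v} → s ≤ t → letter p s i ≡ suc v → letter p t i ≡ suc v
letter-persists p {t = zero}  z≤n e = e
letter-persists p {s} {suc t} {i} {v} s≤t e with m≤n⇒m<n∨m≡n s≤t
... | inj₂ refl      = e
... | inj₁ (s≤s s≤t) = trans (letter-step p t i)
  (cong (λ x → ifZero x (ifZero (i ∸ length (word-1 p t)) (p t) 0) x) (letter-persists p s≤t e))

-- Convergence of staged partial information: a defined value is right at every stage, and each
-- value is eventually available for good. Decoded letters, bounded runs and forced letters all fit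
-- this scheme, so `emit` handles them uniformly.
_⇝_ : (ℕ → ℕ → ℕ) → ℕ^ℕ → Set
L ⇝ q = (∀ {t i v} → L t i ≡ suc v → v ≡ q i) × (∀ i → ∃ λ t₀ → ∀ t → t₀ ≤ t → L t i ≡ suc (q i))

letter-⇝ : ∀ {p q} → p -1≗ q → letter p ⇝ q
letter-⇝ {p} {q} p-1 = (λ {t} → sound {t}) , λ i → proj₁ (p-1 (suc i)) , λ t le → letter-persists p {i = i} le (late i)
  where
  late : ∀ i → letter p (proj₁ (p-1 (suc i))) i ≡ suc (q i)
  late i = trans (cong (λ w → nth w i) (proj₂ (p-1 (suc i)))) (nth-applyUpTo q ≤-refl)
  sound : ∀ {t i v} → letter p t i ≡ suc v → v ≡ q i
  sound {t} {i} e = suc-injective (trans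
    (sym (letter-persists p {i = i} (m≤m⊔n t (proj₁ (p-1 (suc i)))) e))
    (letter-persists p {i = i} (m≤n⊔m t (proj₁ (p-1 (suc i)))) (late i)))

emitted : (ℕ → ℕ → ℕ) → ℕ → ℕ
emitted L = recurse 0 λ t e → ifZero (L t e) e (suc e)

-- Partial values and completed names share one coding, so the approximation to the next letter due
-- is output as it is: 0 is a pause and `suc v` appends v.
emit : (ℕ → ℕ → ℕ) → ℕ^ℕ
emit L t = L t (emitted L t)

module _ {L : ℕ → ℕ → ℕ} {q : ℕ^ℕ} (L⇝q : L ⇝ q) where

  word-1-emit : ∀ t → word-1 (emit L) t ≡ applyUpTo q (emitted L t)
  word-1-emit zero    = refl
  word-1-emit (suc t) = trans (word-1-snoc (emit L) t)
    (trans (cong (_++ letter-1 (emit L t)) (word-1-emit t)) (step (L t (emitted L t)) refl))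
    where
    e = emitted L t
    step : ∀ a → L t e ≡ a → applyUpTo q e ++ letter-1 a ≡ applyUpTo q (ifZero a e (suc e))
    step zero    _  = ++-identityʳ _
    step (suc v) eq = trans (cong (λ v → applyUpTo q e ++ v ∷ []) (proj₁ L⇝q eq)) (sym (applyUpTo-snoc q e))

  emitted-unbounded : ∀ k → ∃ λ t → emitted L t ≡ k
  emitted-unbounded zero    = 0 , refl
  emitted-unbounded (suc k) =
    let t , e = emitted-unbounded k ; t₀ , late = proj₂ L⇝q k in wait t e t₀ late
    where
    wait : ∀ t → emitted L t ≡ k → ∀ t₀ → (∀ u → t₀ ≤ u → L u k ≡ suc (q k)) →
           ∃ λ u → emitted L u ≡ suc k
    wait t e t₀ late = go t₀ t e (m≤n+m t₀ t)
      where
      -- The fuel d bounds the stages left before t₀; from t₀ on, `late` excludes another pause.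
      go : ∀ d t → emitted L t ≡ k → t₀ ≤ t + d → ∃ λ u → emitted L u ≡ suc k
      go d t e le with L t (emitted L t) in eq
      go d       t e le | suc _ = suc t , trans (cong (λ x → ifZero x (emitted L t) (suc (emitted L t))) eq) (cong suc e)
      go zero    t e le | zero
        with () ← trans (sym eq) (trans (cong (L t) e) (late t (subst (t₀ ≤_) (+-identityʳ t) le)))
      go (suc d) t e le | zero  =
        go d (suc t) (trans (cong (λ x → ifZero x (emitted L t) (suc (emitted L t))) eq) e) (subst (t₀ ≤_) (+-suc t d) le)

  emit-1≗ : emit L -1≗ q
  emit-1≗ k = let t , e = emitted-unbounded k in t , trans (word-1-emit t) (cong (applyUpTo q) e)

-- This causality makes `extension` respect `≗` and gives it the modulus t at output place t.
emit-local : ∀ {L L′} t → (∀ u → u ≤ t → L u ≗ L′ u) → emit L t ≡ emit L′ t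
emit-local {L} {L′} t L≗ = trans (L≗ t ≤-refl _) (cong (L′ t) (counts t ≤-refl))
  where
  counts : ∀ u → u ≤ t → emitted L u ≡ emitted L′ u
  counts zero    _  = refl
  counts (suc u) le rewrite counts u (<⇒≤ le) | L≗ u (<⇒≤ le) (emitted L′ u) = refl

lengthᵀ : Total 1
lengthᵀ = restate
  (primrec zeroᵀ (ifZeroᵀ ∙ (oracleᵀ ∙ (var 0F ∷ []) ∷ var 1F ∷ sucᵀ ∙ (var 1F ∷ []) ∷ [])))
  (λ { p (t ∷ []) → length (word-1 p t) }) λ { p (t ∷ []) → eq p t }
  where
  length-++-letter : ∀ w a → length (w ++ letter-1 a) ≡ ifZero a (length w) (suc (length w))
  length-++-letter w zero    = cong length (++-identityʳ w)
  length-++-letter w (suc a) = trans (length-++ w) (+-comm (length w) 1)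
  eq : ∀ p t → recurse 0 (λ t r → ifZero (p t) r (suc r)) t ≡ length (word-1 p t)
  eq p zero    = refl
  eq p (suc t) = trans (cong (λ r → ifZero (p t) r (suc r)) (eq p t))
    (sym (trans (cong length (word-1-snoc p t)) (length-++-letter (word-1 p t) (p t))))

letterᵀ : Total 2
letterᵀ = restate
  (primrec zeroᵀ (ifZeroᵀ ∙ (var 1F
    ∷ ifZeroᵀ ∙ (monusᵀ ∙ (var (2 ↑ʳ 0F) ∷ lengthᵀ ∙ (var 0F ∷ []) ∷ [])
                 ∷ oracleᵀ ∙ (var 0F ∷ []) ∷ zeroᵀ ∷ [])
    ∷ var 1F ∷ [])))
  (λ { p (t ∷ i ∷ []) → letter p t i }) λ { p (t ∷ i ∷ []) → eq p t i }
  where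
  eq : ∀ p t i →
    recurse 0 (λ t r → ifZero r (ifZero (i ∸ length (word-1 p t)) (p t) 0) r) t ≡ letter p t i
  eq p zero    i = refl
  eq p (suc t) i = trans (cong (λ r → ifZero r (ifZero (i ∸ length (word-1 p t)) (p t) 0) r) (eq p t i)) (sym (letter-step p t i))

emitᵀ : Total (2 + n) → Total (suc n)
emitᵀ {n} f = restate
  (f ∙ (var 0F
       ∷ primrec zeroᵀ (ifZeroᵀ ∙ (f ∷ var 1F ∷ sucᵀ ∙ (var 1F ∷ []) ∷ []))
       ∷ tabulate (var ∘ (1 ↑ʳ_))))
  (λ { p (t ∷ xs) → emit (λ t i → eval f p (t ∷ i ∷ xs)) t })
  λ { p (t ∷ xs) → cong (λ ys → eval f p (t ∷ emitted (λ t i → eval f p (t ∷ i ∷ xs)) t ∷ ys)) (evalAll-vars (1 ↑ʳ_) xs λ _ → refl) }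


-- Step-bounded evaluation of codes on a partially known oracle

defined : Vec ℕ m → ℕ
defined []       = 1
defined (y ∷ ys) = ifZero y 0 (defined ys)

-- The values v of g being coded as partial values, the state r is 1 while all of them are defined
-- and nonzero (v ≥ 2), 2 + y once the first zero (v = 1) is found at y, and 0 after an undefined one.
search-step : ℕ → ℕ → ℕ → ℕ
search-step v x r = ifZero r 0 (ifZero (pred r) (ifZero v 0 (ifZero (pred v) (2 + x) 1)) r)

search : (ℕ → ℕ) → ℕ → ℕ
search g = recurse 1 λ x → search-step (g x) x

-- run c L s executes c on the approximation L s of the oracle, with μ restricted to values
-- below s.
run  : Code n → (ℕ → ℕ → ℕ) → ℕ → Vec ℕ n → ℕ
run* : Vec (Code n) m → (ℕ → ℕ → ℕ) → ℕ → Vec ℕ n → Vec ℕ m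
run-prec : Code n → Code (2 + n) → (ℕ → ℕ → ℕ) → ℕ → Vec ℕ n → ℕ → ℕ
run zero        L s xs       = 1
run suc         L s (x ∷ []) = 2 + x
run (proj i)    L s xs       = suc (lookup xs i)
run oracle      L s (x ∷ []) = L s x
run (comp c ds) L s xs       =
  ifZero (defined (run* ds L s xs)) 0 (run c L s (Vec.map pred (run* ds L s xs)))
run (prec c d)  L s (x ∷ xs) = run-prec c d L s xs x
run (μ c)       L s xs       = pred (search (λ x → run c L s (x ∷ xs)) s)
run* []       L s xs = []
run* (c ∷ cs) L s xs = run c L s xs ∷ run* cs L s xs
run-prec c d L s xs = recurse (run c L s xs) λ x r → ifZero r 0 (run d L s (x ∷ pred r ∷ xs))

search-1 : ∀ g k → search g k ≡ 1 → ∀ x → x < k → ∃ λ v → g x ≡ 2 + v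
search-1 g (suc k) e x x<k with search g k in eq
search-1 g (suc k) e x x<k | 1 with g k in eq′
search-1 g (suc k) e x x<k | 1 | suc (suc v) with m≤n⇒m<n∨m≡n x<k
... | inj₁ (s≤s x<k) = search-1 g k eq x x<k
... | inj₂ refl      = v , eq′

search-found : ∀ g k {y} → search g k ≡ 2 + y → g y ≡ 1 × (∀ x → x < y → ∃ λ v → g x ≡ 2 + v)
search-found g (suc k) e with search g k in eq
search-found g (suc k) e | 1 with g k in eq′
search-found g (suc k) refl | 1 | 1 = eq′ , search-1 g k eq
search-found g (suc k) e | suc (suc y) = search-found g k (trans eq e)

search-below : ∀ g k → (∀ x → x < k → ∃ λ v → g x ≡ 2 + v) → search g k ≡ 1
search-below g zero    below = refl
search-below g (suc k) below
  rewrite search-below g k (λ x x<k → below x (m≤n⇒m≤1+n x<k)) | proj₂ (below k ≤-refl) = refl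

search-finds : ∀ g {y} → g y ≡ 1 → (∀ x → x < y → ∃ λ v → g x ≡ 2 + v) →
               ∀ k → y < k → search g k ≡ 2 + y
search-finds g e below (suc k) y<k with m≤n⇒m<n∨m≡n y<k
... | inj₁ (s≤s y<k) rewrite search-finds g e below k y<k = refl
... | inj₂ refl      rewrite search-below g k below | e = refl

definedᵀ : Vec (Total n) m → Total n
definedᵀ []       = oneᵀ
definedᵀ (f ∷ fs) = ifZeroᵀ ∙ (f ∷ zeroᵀ ∷ definedᵀ fs ∷ [])

-- The bounded evaluator is compiled separately for each code, by recursion on it; this takes the
-- place of a universal machine. The additional first argument is the stage.
approx  : Code n → Total (suc n)
approx* : Vec (Code n) m → Vec (Total (suc n)) m
approx zero        = oneᵀ
approx suc         = sucᵀ ∙ (sucᵀ ∙ (var 1F ∷ []) ∷ [])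
approx (proj i)    = sucᵀ ∙ (var (suc i) ∷ [])
approx oracle      = letterᵀ
approx (comp c ds) = ifZeroᵀ ∙
  (definedᵀ (approx* ds) ∷ zeroᵀ ∷ approx c ∙ (var 0F ∷ Vec.map (λ f → predᵀ ∙ (f ∷ [])) (approx* ds)) ∷ [])
approx (prec c d)  =
  primrec (approx c) (ifZeroᵀ ∙ (var 1F ∷ zeroᵀ
    ∷ approx d ∙ (var 2F ∷ var 0F ∷ predᵀ ∙ (var 1F ∷ []) ∷ tabulate (var ∘ (3 ↑ʳ_))) ∷ []))
  ∙ (var 1F ∷ var 0F ∷ tabulate (var ∘ (2 ↑ʳ_)))
approx {n} (μ c)   =
  predᵀ ∙ (primrec oneᵀ (stepᵀ ∙ (approx c ∙ (var 2F ∷ var 0F ∷ tabulate (var ∘ (3 ↑ʳ_)))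
                                  ∷ var 0F ∷ var 1F ∷ []))
           ∙ (var 0F ∷ var 0F ∷ tabulate (var ∘ (1 ↑ʳ_))) ∷ [])
  where
  stepᵀ : Total 3
  stepᵀ = restate
    (ifZeroᵀ ∙ (var 2F ∷ zeroᵀ ∷ ifZeroᵀ ∙ (predᵀ ∙ (var 2F ∷ [])
      ∷ ifZeroᵀ ∙ (var 0F ∷ zeroᵀ ∷ ifZeroᵀ ∙ (predᵀ ∙ (var 0F ∷ [])
        ∷ sucᵀ ∙ (sucᵀ ∙ (var 1F ∷ []) ∷ []) ∷ oneᵀ ∷ []) ∷ [])
      ∷ var 2F ∷ []) ∷ []))
    (λ { _ (v ∷ x ∷ r ∷ []) → search-step v x r }) λ { _ (_ ∷ _ ∷ _ ∷ []) → refl }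
approx* []       = []
approx* (c ∷ cs) = approx c ∷ approx* cs

recurse-cong : ∀ {a b f g} → a ≡ b → (∀ x y → f x y ≡ g x y) → recurse a f ≗ recurse b g
recurse-cong         a≡b f≗g zero    = a≡b
recurse-cong {g = g} a≡b f≗g (suc x) = trans (f≗g x _) (cong (g x) (recurse-cong a≡b f≗g x))

eval-approx : ∀ (c : Code n) p s xs → eval (approx c) p (s ∷ xs) ≡ run c (letter p) s xs
eval-approx* : ∀ (cs : Vec (Code n) m) p s xs → evalAll (approx* cs) p (s ∷ xs) ≡ run* cs (letter p) s xs
eval-approx zero        p s xs       = refl
eval-approx suc         p s (x ∷ []) = refl
eval-approx (proj i)    p s xs       = refl
eval-approx oracle      p s (x ∷ []) = refl
eval-approx (comp c ds) p s xs       =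
  cong₂ (λ d r → ifZero d 0 r)
    (trans (eval-defined (approx* ds)) (cong defined (eval-approx* ds p s xs)))
    (trans (eval-approx c p s _) (cong (run c (letter p) s)
      (trans (eval-preds (approx* ds)) (cong (Vec.map pred) (eval-approx* ds p s xs)))))
  where
  eval-defined : ∀ {k} (fs : Vec (Total _) k) → eval (definedᵀ fs) p (s ∷ xs) ≡ defined (evalAll fs p (s ∷ xs))
  eval-defined []       = refl
  eval-defined (f ∷ fs) = cong (ifZero (eval f p (s ∷ xs)) 0) (eval-defined fs)
  eval-preds : ∀ {k} (fs : Vec (Total _) k) →
    evalAll (Vec.map (λ f → predᵀ ∙ (f ∷ [])) fs) p (s ∷ xs) ≡ Vec.map pred (evalAll fs p (s ∷ xs))
  eval-preds []       = refl
  eval-preds (f ∷ fs) = cong (_ ∷_) (eval-preds fs)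
eval-approx (prec c d)  p s (x ∷ xs)
  rewrite evalAll-vars {p = p} {s ∷ x ∷ xs} (2 ↑ʳ_) xs (λ _ → refl) =
  recurse-cong (eval-approx c p s xs)
    (λ x r → cong (ifZero r 0) (trans
      (cong (λ ys → eval (approx d) p (s ∷ x ∷ pred r ∷ ys)) (evalAll-vars (3 ↑ʳ_) xs λ _ → refl))
      (eval-approx d p s _))) x
eval-approx (μ c)       p s xs
  rewrite evalAll-vars {p = p} {s ∷ xs} (1 ↑ʳ_) xs (λ _ → refl) =
  cong pred (recurse-cong refl (λ x r → cong (λ v → search-step v x r) (trans
      (cong (λ ys → eval (approx c) p (s ∷ x ∷ ys)) (evalAll-vars (3 ↑ʳ_) xs λ _ → refl))
      (eval-approx c p s _))) s)
eval-approx* []       p s xs = refl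
eval-approx* (c ∷ cs) p s xs = cong₂ _∷_ (eval-approx c p s xs) (eval-approx* cs p s xs)

module _ {L : ℕ → ℕ → ℕ} {q : ℕ^ℕ} (L⇝q : L ⇝ q) where

  -- No lower bound on the stage is involved: a defined result rests only on defined oracle values,
  -- and these are values of `q`.
  run-sound  : ∀ (c : Code n) {s xs v} → run c L s xs ≡ suc v → q ⊢ c [ xs ]⇓ v
  run*-sound : ∀ (cs : Vec (Code n) m) {s xs w} → defined (run* cs L s xs) ≡ suc w →
               Pointwise (λ c y → q ⊢ c [ xs ]⇓ y) cs (Vec.map pred (run* cs L s xs))
  run-prec-sound : ∀ (c : Code n) d {s xs} x {v} → run-prec c d L s xs x ≡ suc v →
                   q ⊢ prec c d [ x ∷ xs ]⇓ v
  run-sound zero     refl                = zero⇓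
  run-sound suc      {xs = _ ∷ []} refl  = suc⇓
  run-sound (proj i) refl                = proj⇓ i
  run-sound oracle   {s} {x ∷ []} e      =
    subst (q ⊢ oracle [ x ∷ [] ]⇓_) (sym (proj₁ L⇝q {s} e)) oracle⇓
  run-sound (comp c ds) {s} {xs} e with defined (run* ds L s xs) in eq
  ... | suc _ = comp⇓ (run*-sound ds eq) (run-sound c e)
  run-sound (prec c d) {xs = x ∷ xs} e   = run-prec-sound c d x e
  run-sound (μ c) {s} {xs} e with search (λ x → run c L s (x ∷ xs)) s in eq
  -- Only the state `2 + y` remains a defined value under `pred`; the states 0 and 1 both become 0.
  run-sound (μ c) {s} {xs} refl | suc (suc y) =
    let found , below = search-found (λ x → run c L s (x ∷ xs)) s eq
    in μ⇓ (run-sound c found) λ x x<y → let v , e = below x x<y in v , run-sound c e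
  run*-sound []       e = []
  run*-sound (c ∷ cs) {s} {xs} e with run c L s xs in eq
  ... | suc v = run-sound c eq ∷ run*-sound cs e
  run-prec-sound c d zero e = prec-z⇓ (run-sound c e)
  run-prec-sound c d {s} {xs} (suc x) e with run-prec c d L s xs x in eq
  ... | suc r = prec-s⇓ (run-prec-sound c d x eq) (run-sound d e)

  Eventually : (ℕ → Set) → Set
  Eventually P = ∃ λ t₀ → ∀ t → t₀ ≤ t → P t

  run-complete  : ∀ {c : Code n} {xs v} → q ⊢ c [ xs ]⇓ v → Eventually λ s → run c L s xs ≡ suc v
  run*-complete : ∀ {cs : Vec (Code n) m} {xs ys} → Pointwise (λ c y → q ⊢ c [ xs ]⇓ y) cs ys →
                  Eventually λ s → run* cs L s xs ≡ Vec.map suc ys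
  run-complete zero⇓         = 0 , λ _ _ → refl
  run-complete suc⇓          = 0 , λ _ _ → refl
  run-complete (proj⇓ i)     = 0 , λ _ _ → refl
  run-complete (oracle⇓ {x}) = proj₂ L⇝q x
  run-complete (comp⇓ {c = c} {ys = ys} ds h) =
    let s₀ , f = run*-complete ds ; s₁ , g = run-complete h
    in s₀ ⊔ s₁ , λ s le → trans
      (cong (λ ys → ifZero (defined ys) 0 (run c L s (Vec.map pred ys))) (f s (m⊔n≤o⇒m≤o s₀ s₁ le)))
      (trans (defined-sucs ys _)
        (trans (cong (run c L s) (pred-sucs ys)) (g s (m⊔n≤o⇒n≤o s₀ s₁ le))))
    where
    defined-sucs : ∀ {k} (ys : Vec ℕ k) a → ifZero (defined (Vec.map suc ys)) 0 a ≡ a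
    defined-sucs []       a = refl
    defined-sucs (_ ∷ ys) a = defined-sucs ys a
    pred-sucs : ∀ {k} (ys : Vec ℕ k) → Vec.map pred (Vec.map suc ys) ≡ ys
    pred-sucs []       = refl
    pred-sucs (y ∷ ys) = cong (y ∷_) (pred-sucs ys)
  run-complete (prec-z⇓ h) = run-complete h
  run-complete (prec-s⇓ {d = d} {x} {xs} h h′) =
    let s₀ , f = run-complete h ; s₁ , g = run-complete h′
    in s₀ ⊔ s₁ , λ s le → trans
      (cong (λ r → ifZero r 0 (run d L s (x ∷ pred r ∷ xs))) (f s (m⊔n≤o⇒m≤o s₀ s₁ le)))
      (g s (m⊔n≤o⇒n≤o s₀ s₁ le))
  run-complete (μ⇓ {c = c} {xs} {y} found below) =
    let s₀ , f = run-complete found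
        s₁ , g = bounded-max (λ x s₀ → ∀ s → s₀ ≤ s → ∃ λ v → run c L s (x ∷ xs) ≡ 2 + v)
                   (λ i≤j h s j≤s → h s (≤-trans i≤j j≤s)) y
                   (λ x x<y → each (proj₂ (below x x<y)))
    -- At stage s the search tries only values below s, so s must exceed y.
    in suc y ⊔ (s₀ ⊔ s₁) , λ s le →
      let le′ = m⊔n≤o⇒n≤o (suc y) (s₀ ⊔ s₁) le
      in cong pred (search-finds (λ x → run c L s (x ∷ xs))
           (f s (m⊔n≤o⇒m≤o s₀ s₁ le′)) (λ x x<y → g x x<y s (m⊔n≤o⇒n≤o s₀ s₁ le′))
           s (m⊔n≤o⇒m≤o (suc y) (s₀ ⊔ s₁) le))
    where
    each : ∀ {x v} → q ⊢ c [ x ∷ xs ]⇓ suc v →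
           ∃ λ s₀ → ∀ s → s₀ ≤ s → ∃ λ v → run c L s (x ∷ xs) ≡ 2 + v
    each {v = v} h = let s₀ , f = run-complete h in s₀ , λ s le → v , f s le
  run*-complete []       = 0 , λ _ _ → refl
  run*-complete (h ∷ hs) =
    let s₀ , f = run-complete h ; s₁ , g = run*-complete hs
    in s₀ ⊔ s₁ , λ s le → cong₂ _∷_ (f s (m⊔n≤o⇒m≤o s₀ s₁ le)) (g s (m⊔n≤o⇒n≤o s₀ s₁ le))

-- Totality is demanded at all p, even where p - 1 is finite or outside the domain of `F`: in
-- `Σ-mono` one component is known to be right, but every component must produce an output.
record Completes (F̂ F : Baire ⇀ Baire) : Set where
  field
    isTotal : ∀ p → ∃ λ r → F̂ ∋ p ↦ r
    extends : ∀ {p q r r′} → p -1≗ q → F ∋ q ↦ r → F̂ ∋ p ↦ r′ → r′ -1≗ r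

computable-completion : ∀ {F} → Computable F → ∃ λ F̂ → Computable F̂ × Completes F̂ F
computable-completion {F} (c , computes) =
  ⟦ code f ⟧ , ⟦⟧-computable (code f) , record
    { isTotal = λ p → functional f p , ⟦⟧-functional f p
    ; extends = λ {p} p-1 h h′ → -1≗-respˡ
        (_⇀_.singleValued ⟦ code f ⟧ (⟦⟧-functional f p) h′)
        (emit-1≗ (converges p (letter-⇝ p-1) h))
    }
  where
  f = emitᵀ (approx c)
  converges : ∀ p {q r} → letter p ⇝ q → F ∋ q ↦ r → (λ t i → eval (approx c) p (t ∷ i ∷ [])) ⇝ r
  converges p {q} {r} L⇝q h =
    (λ {t} {i} e → ⇓-deterministic
      (run-sound L⇝q c (trans (sym (eval-approx c p t (i ∷ []))) e)) (computes q r h i)) ,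
    λ i → let t₀ , late = run-complete L⇝q (computes q r h i) in
      t₀ , λ t le → trans (eval-approx c p t (i ∷ [])) (late t le)

-- Completion of continuous functionals

applyUpTo-cong-≗[] : ∀ {p q} t → p ≗[ t ] q → applyUpTo p t ≡ applyUpTo q t
applyUpTo-cong-≗[] zero    e = refl
applyUpTo-cong-≗[] (suc t) e =
  cong₂ _∷_ (e 0 (s≤s z≤n)) (applyUpTo-cong-≗[] t λ i i<t → e (suc i) (s≤s i<t))

module _ (em : ExcludedMiddle 0ℓ) (F : Baire ⇀ Baire) where

  Compatible : List ℕ → ℕ^ℕ → Set
  Compatible w q = ∀ i v → nth w i ≡ suc v → v ≡ q i

  -- The first conjunct provides a compatible point of the domain; without one, every v would be
  -- forced vacuously. It is what makes the forced value unique.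
  Forces : List ℕ → ℕ → ℕ → Set
  Forces w i v = (∃₂ λ q r → (F ∋ q ↦ r) × Compatible w q)
               × (∀ q r → F ∋ q ↦ r → Compatible w q → r i ≡ v)

  forced : List ℕ → ℕ → ℕ
  forced w i with em {∃ (Forces w i)}
  ... | yes (v , _) = suc v
  ... | no _        = 0

  forced-sound : ∀ w i {v} → forced w i ≡ suc v → Forces w i v
  forced-sound w i e with em {∃ (Forces w i)}
  forced-sound w i refl | yes (v , forces) = forces

  forced-complete : ∀ w i {v} → Forces w i v → forced w i ≡ suc v
  forced-complete w i forces with em {∃ (Forces w i)}
  forced-complete w i ((q , r , h , compat) , unique) | yes (_ , _ , unique′) =
    cong suc (trans (sym (unique′ q r h compat)) (unique q r h compat))
  forced-complete w i {v} forces | no ¬forces = contradiction (v , forces) ¬forces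

  extension : Baire ⇀ Baire
  extension = record
    { multi = record
      { Graph = λ p r → r ≗ emit (forced ∘ word-1 p)
      ; resp  = λ p≗ r≗ e t → trans (sym (r≗ t)) (trans (e t)
          (emit-local t λ u _ i → cong (λ w → forced (concatMap letter-1 w) i) (applyUpTo-cong p≗ u)))
      }
    ; singleValued = λ e e′ t → trans (e t) (sym (e′ t))
    }

  extension-continuous : Continuous extension
  extension-continuous = pointwise⇒Continuous extension λ p r e t →
    t , λ p′ r′ e′ p≗ → trans (e t) (trans
      (emit-local t λ u u≤t i → cong (λ w → forced (concatMap letter-1 w) i)
        (applyUpTo-cong-≗[] u (≗[]-weaken u≤t p≗)))
      (sym (e′ t)))

  -- Every word decoded from p is compatible with q, so a forced value agrees with r. Once the word
  -- covers the modulus of `F` at q, continuity forces the letter.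
  forced-⇝ : Continuous F → ∀ {p q r} → p -1≗ q → F ∋ q ↦ r → (forced ∘ word-1 p) ⇝ r
  forced-⇝ cont {p} {q} {r} p-1 h =
    (λ {t} {i} e → sym (proj₂ (forced-sound (word-1 p t) i e) q r h (compatible t))) ,
    λ i →
      let b , F≗ = cont q r h (suc i)
          t₀ , late = bounded-max (λ j t₀ → ∀ t → t₀ ≤ t → letter p t j ≡ suc (q j))
                        (λ i≤j f t j≤t → f t (≤-trans i≤j j≤t)) b (λ j _ → proj₂ letters j)
      in t₀ , λ t le → forced-complete (word-1 p t) i
           ( (q , r , h , compatible t)
           , λ q′ r′ h′ compat → sym (F≗ q′ r′ h′ (λ j j<b → compat j (q j) (late j j<b t le)) i ≤-refl))
    where
    letters = letter-⇝ p-1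
    compatible : ∀ t → Compatible (word-1 p t) q
    compatible t i v = proj₁ letters {t}

  continuous-completion : Continuous F → ∃ λ F̂ → Continuous F̂ × Completes F̂ F
  continuous-completion cont = extension , extension-continuous , record
    { isTotal = λ p → _ , λ _ → refl
    ; extends = λ p-1 h e → -1≗-respˡ (λ t → sym (e t)) (emit-1≗ (forced-⇝ cont p-1 h))
    }

-- Reducibilities

-- These closure properties are all that the reductions draw on; with `Mode` as a second parameter,
-- one argument covers the four reducibilities.
record FunctionClass : Set₁ where
  field
    Member            : Baire ⇀ Baire → Set
    computable        : ∀ {F} → Computable F → Member F
    ∘-closed          : ∀ {F G} → Member F → Member G → Member (F ∘⇀ G)
    ⟨,⟩-closed        : ∀ {F G} → Member F → Member G → Member ⟨ F , G ⟩⇀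
    parallel-closed   : ∀ {F} → Member F → Member (parallel F)
    completion-closed : ∀ {F} → Member F → ∃ λ F̂ → Member F̂ × Completes F̂ F

  total : ∀ f → Member ⟦ code f ⟧
  total f = computable (⟦⟧-computable (code f))

computableFunctions : FunctionClass
computableFunctions = record
  { Member            = Computable
  ; computable        = λ h → h
  ; ∘-closed          = λ {F} {G} → ∘-computable {F} {G}
  ; ⟨,⟩-closed        = λ {F} {G} → ⟨,⟩⇀-computable {F} {G}
  ; parallel-closed   = λ {F} → parallel-computable {F}
  ; completion-closed = λ {F} → computable-completion {F}
  }

continuousFunctions : ExcludedMiddle 0ℓ → FunctionClass
continuousFunctions em = record
  { Member            = Continuous
  ; computable        = λ {F} → Computable⇒Continuous {F}
  ; ∘-closed          = λ {F} {G} → ∘-continuous {F} {G}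
  ; ⟨,⟩-closed        = λ {F} {G} → ⟨,⟩⇀-continuous {F} {G}
  ; parallel-closed   = λ {F} → parallel-continuous {F}
  ; completion-closed = λ {F} → continuous-completion em F
  }

data Mode : Set where
  strong weak : Mode

input : Mode → ℕ^ℕ → ℕ^ℕ → ℕ^ℕ
input strong p q = q
input weak   p q = ⟨ p , q ⟩

composite : Mode → (H G K : Baire ⇀ Baire) → Baire ⇀ Baire
composite strong H G K = H ∘⇀ G ∘⇀ K
composite weak   H G K = H ∘⇀ ⟨id, G ∘⇀ K ⟩

composite-intro : ∀ mode {H G K : Baire ⇀ Baire} {p k t u} → K ∋ p ↦ k → G ∋ k ↦ t → H ∋ input mode p t ↦ u →
                  composite mode H G K ∋ p ↦ u
composite-intro strong k g h = _ , (_ , k , g) , h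
composite-intro weak   k g h = _ , (_ , (_ , k , g) , λ _ → refl) , h

composite-elim : ∀ mode {H G K : Baire ⇀ Baire} {p u} → composite mode H G K ∋ p ↦ u →
  ∃₂ λ k t → (K ∋ p ↦ k) × (G ∋ k ↦ t) × (H ∋ input mode p t ↦ u)
composite-elim strong     (t , (k , K∋ , G∋) , H∋)             = k , t , K∋ , G∋ , H∋
composite-elim weak   {H} (_ , (t , (k , K∋ , G∋) , e) , H∋) =
  k , t , K∋ , G∋ , _⇉_.resp (multi H) e (λ _ → refl) H∋

open Problem
open Setoid using (Carrier)
open RepresentedSpace using (space; δ)

ReducesVia : Mode → (H K : Baire ⇀ Baire) → Problem → Problem → Set₁
ReducesVia mode H K f g = ∀ G → G Realizes g → composite mode H G K Realizes f

record Answer (mode : Mode) (H : Baire ⇀ Baire) (f : Problem) (p : ℕ^ℕ)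
              (x : Carrier (space (source f))) (t : ℕ^ℕ) : Set where
  constructor answered
  field
    {output}   : ℕ^ℕ
    {solution} : Carrier (space (target f))
    H∋         : H ∋ input mode p t ↦ output
    names      : δ (target f) ∋ output ↦ solution
    solves     : solution ∈ fun f [ x ]

record Query (mode : Mode) (H K : Baire ⇀ Baire) (f g : Problem) (p : ℕ^ℕ)
             (x : Carrier (space (source f))) : Set where
  constructor asks
  field
    {query}  : ℕ^ℕ
    {posed}  : Carrier (space (source g))
    K∋       : K ∋ p ↦ query
    names    : δ (source g) ∋ query ↦ posed
    solvable : dom (fun g) posed
    answer   : ∀ {t y} → δ (target g) ∋ t ↦ y → y ∈ fun g [ posed ] → Answer mode H f p x t

-- Mentions no realizers, so each component of an answer to `Π g` or `Σ g` can be processed by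
-- itself, whatever it owes to the other components of the instance.
ReducesPointwise : Mode → (H K : Baire ⇀ Baire) → Problem → Problem → Set
ReducesPointwise mode H K f g =
  ∀ {p x} → δ (source f) ∋ p ↦ x → dom (fun f) x → Query mode H K f g p x

pointwise⇒via : ∀ mode {H K f g} → ReducesPointwise mode H K f g → ReducesVia mode H K f g
pointwise⇒via mode reduce G realizes p x p↦x d =
  let asks K∋ k↦z d′ answer = reduce p↦x d
      t , G∋ , y , t↦y , y∈ = realizes _ _ k↦z d′
      answered H∋ u↦w w∈ = answer t↦y y∈
  in _ , composite-intro mode K∋ G∋ H∋ , _ , u↦w , w∈

-- Restricting a realizer of g to names of instances of g shows that K maps names of instances
-- to names of instances; changing its value at a single name shows that H can deal
-- with every solution.
via⇒pointwise : ExcludedMiddle 0ℓ → ∀ mode {H K f g} →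
                ReducesVia mode H K f g → ReducesPointwise mode H K f g
via⇒pointwise em mode {H} {K} {f} {g} via {p} {x} p↦x d =
  let _ , defined , _ = via restricted restricted-realizes p x p↦x d
      k , _ , K∋ , (_ , z , k↦z , d′) , _ = composite-elim mode {H} {restricted} {K} defined
  in asks K∋ k↦z d′ (answer K∋ k↦z)
  where
  G = proj₁ (realizable g)
  G-realizes = proj₂ (realizable g)

  restricted : Baire ⇀ Baire
  restricted = record
    { multi = record
      { Graph = λ s t → (G ∋ s ↦ t) × ∃ λ z → (δ (source g) ∋ s ↦ z) × dom (fun g) z
      ; resp  = λ s≗ t≗ (h , z , s↦z , d) →
          _⇉_.resp (multi G) s≗ t≗ h , z ,
          _⇉_.resp (multi (δ (source g))) s≗ (Setoid.refl (space (source g))) s↦z , d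
      }
    ; singleValued = λ (h , _) (h′ , _) → _⇀_.singleValued G h h′
    }

  restricted-realizes : restricted Realizes g
  restricted-realizes s z s↦z d =
    let t , G∋ , rest = G-realizes s z s↦z d in t , (G∋ , z , s↦z , d) , rest

  module _ {k z} (K∋ : K ∋ p ↦ k) (k↦z : δ (source g) ∋ k ↦ z)
           {t y} (t↦y : δ (target g) ∋ t ↦ y) (y∈ : y ∈ fun g [ z ]) where

    overridden : Baire ⇀ Baire
    overridden = record
      { multi = record
        { Graph = λ s t′ → (s ≗ k × t′ ≗ t) ⊎ (¬ s ≗ k × (G ∋ s ↦ t′))
        ; resp  = λ
            { s≗ t≗ (inj₁ (e , e′)) → inj₁ ((λ i → trans (sym (s≗ i)) (e i)) , λ i → trans (sym (t≗ i)) (e′ i))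
            ; s≗ t≗ (inj₂ (¬e , h)) → inj₂ ((λ e → ¬e λ i → trans (s≗ i) (e i)) , _⇉_.resp (multi G) s≗ t≗ h) }
        }
      ; singleValued = λ
          { (inj₁ (_ , e))  (inj₁ (_ , e′))  i → trans (e i) (sym (e′ i))
          ; (inj₁ (e , _))  (inj₂ (¬e , _))    → contradiction e ¬e
          ; (inj₂ (¬e , _)) (inj₁ (e , _))     → contradiction e ¬e
          ; (inj₂ (_ , h))  (inj₂ (_ , h′))    → _⇀_.singleValued G h h′ }
      }

    overridden-realizes : overridden Realizes g
    overridden-realizes s z′ s↦z′ d with em {s ≗ k}
    ... | yes e = t , inj₁ (e , λ _ → refl) , y , t↦y ,
      _⇉_.resp (fun g)
        (_⇀_.singleValued (δ (source g)) k↦z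
          (_⇉_.resp (multi (δ (source g))) e (Setoid.refl (space (source g))) s↦z′))
        (Setoid.refl (space (target g))) y∈
    ... | no ¬e = let t , G∋ , rest = G-realizes s z′ s↦z′ d in t , inj₂ (¬e , G∋) , rest

    answer : Answer mode H f p x t
    answer with via overridden overridden-realizes p x p↦x d
    ... | u , defined , w , u↦w , w∈ with composite-elim mode {H} {overridden} {K} defined
    ... | k′ , t′ , K∋′ , inj₁ (_ , t′≗t) , H∋ =
      answered (_⇉_.resp (multi H) (input-cong mode t′≗t) (λ _ → refl) H∋) u↦w w∈
      where
      input-cong : ∀ mode {p q q′} → q ≗ q′ → input mode p q ≗ input mode p q′
      input-cong strong e = e
      input-cong weak   e = ⟨,⟩-cong (λ _ → refl) e
    -- `K` is single-valued, so the query made at p is k, where the override applies.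
    ... | k′ , t′ , K∋′ , inj₂ (¬e , _) , _ = contradiction (_⇀_.singleValued K K∋′ K∋) ¬e

-- Completed names and rearrangements of sequences

name-resp : ∀ X {p q x} → p ≗ q → δ X ∋ p ↦ x → δ X ∋ q ↦ x
name-resp X e = _⇉_.resp (multi (δ X)) e (Setoid.refl (space X))

completed-name : ∀ Y {p ŷ y} → δ (completion Y) ∋ p ↦ ŷ → Setoid._≈_ (space (completion Y)) ŷ (just y) →
                 ∃ λ q → p -1≗ q × (δ Y ∋ q ↦ y)
completed-name Y p↦ŷ e = _⇉_.resp (multi (δ (completion Y))) (λ _ → refl) e p↦ŷ

stashing-dom : ∀ {A B} (f : A ⇉ B) {xs} → (∀ n → dom f (xs n)) → dom (stashing f) xs
stashing-dom {B = B} f d =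
  (λ n → just (proj₁ (d n))) , d , 0 , proj₁ (d 0) , Setoid.refl (Maybe.setoid B) , proj₂ (d 0)

-- Fuses two layers of completion: letters 0 and 1 of p contribute nothing to r and `2 + v`
-- contributes v, while `pred` maps them to 0, 0 and `suc v`.
pred-1≗ : ∀ {p q r} → p -1≗ q → q -1≗ r → (pred ∘ p) -1≗ r
pred-1≗ {p} {q} p-1 q-1 k =
  let m , e = q-1 k ; m′ , e′ = p-1 m in m′ , trans (words p m′) (trans (cong (concatMap letter-1) e′) e)
  where
  letters : ∀ a → letter-1 (pred a) ≡ concatMap letter-1 (letter-1 a)
  letters zero    = refl
  letters (suc a) = sym (++-identityʳ _)
  words : ∀ p m → word-1 (pred ∘ p) m ≡ concatMap letter-1 (word-1 p m)
  words p zero    = refl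
  words p (suc m) = trans (cong₂ _++_ (letters (p 0)) (words (p ∘ suc) m))
    (sym (concatMap-++ letter-1 (letter-1 (p 0)) (word-1 (p ∘ suc) m)))

infixr 9 _∘ᵀ_

_∘ᵀ_ : Total n → Total 1 → Total n
f ∘ᵀ g = record
  { code    = comp (relativize (comp (code g) (proj 1F ∷ [])) (code f)) (zero ∷ tabulate proj)
  ; eval    = λ p → eval f (functional g p)
  ; correct = λ p xs → comp⇓ (zero⇓ ∷ projections⇓ (λ i → i) xs λ _ → refl)
      (relativize⇓ (λ _ → comp⇓ (proj⇓ 1F ∷ []) (correct g p _)) (correct f _ xs))
  }

reindex : Total 1 → Total 1
reindex f = oracleᵀ ∙ (f ∷ [])

firstᵀ secondᵀ : Total 1
firstᵀ  = reindex doubleᵀ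
secondᵀ = reindex (addᵀ ∙ (doubleᵀ ∷ oneᵀ ∷ []))

-- All but `spreadᵀ` only relocate letters: each formula decodes an output position and gives the
-- input position to read.
headᵀ repeatᵀ flattenᵀ curryᵀ transposeᵀ spreadᵀ : Total 1
headᵀ      = reindex (pairᵀ ∙ (zeroᵀ ∷ var 0F ∷ []))
repeatᵀ    = reindex sndᵀ
flattenᵀ   = reindex (pairᵀ ∙ (fstᵀ ∙ (fstᵀ ∷ []) ∷ pairᵀ ∙ (sndᵀ ∙ (fstᵀ ∷ []) ∷ sndᵀ ∷ []) ∷ []))
curryᵀ     = reindex (pairᵀ ∙ (pairᵀ ∙ (fstᵀ ∷ fstᵀ ∙ (sndᵀ ∷ []) ∷ []) ∷ sndᵀ ∙ (sndᵀ ∷ []) ∷ []))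
transposeᵀ = reindex (pairᵀ ∙ (fstᵀ ∙ (sndᵀ ∷ []) ∷ pairᵀ ∙ (fstᵀ ∷ sndᵀ ∙ (sndᵀ ∷ []) ∷ []) ∷ []))
-- From a completed name of a sequence, completed names of all its members.
spreadᵀ    = emitᵀ (letterᵀ ∙ (var 0F ∷ pairᵀ ∙ (var 2F ∷ var 1F ∷ []) ∷ [])) ∙ (sndᵀ ∷ fstᵀ ∷ [])

component-repeat : ∀ p n → component (functional repeatᵀ p) n ≗ p
component-repeat p n k = cong (p ∘ proj₂) (unpair-pair n k)

component-flatten : ∀ p l → let n , k = unpair l in
  component (functional flattenᵀ p) l ≗ component (component p n) k
component-flatten p l j =
  cong (λ (l , j) → p (pair (proj₁ (unpair l)) (pair (proj₂ (unpair l)) j))) (unpair-pair l j)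

component-flatten-pair : ∀ p n k → component (functional flattenᵀ p) (pair n k) ≗ component (component p n) k
component-flatten-pair p n k j = trans (component-flatten p (pair n k) j)
  (cong (λ (n , k) → p (pair n (pair k j))) (unpair-pair n k))

component-curry : ∀ p n k → component (component (functional curryᵀ p) n) k ≗ component p (pair n k)
component-curry p n k j = trans
  (cong (λ (n , l) → p (pair (pair n (proj₁ (unpair l))) (proj₂ (unpair l)))) (unpair-pair n (pair k j)))
  (cong (λ (k , j) → p (pair (pair n k) j)) (unpair-pair k j))

component-transpose : ∀ p n k →
  component (component (functional transposeᵀ p) n) k ≗ component (component p k) n
component-transpose p n k j = trans
  (cong (λ (n , l) → p (pair (proj₁ (unpair l)) (pair n (proj₂ (unpair l))))) (unpair-pair n (pair k j)))
  (cong (λ (k , j) → p (pair k (pair n j))) (unpair-pair k j))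

spread-1≗ : ∀ {p q} → p -1≗ q → ∀ n → component (functional spreadᵀ p) n -1≗ component q n
spread-1≗ {p} {q} p-1 n = -1≗-respˡ
  (λ k → sym (cong (λ (n , k) → emit (λ t i → letter p t (pair n i)) k) (unpair-pair n k)))
  (emit-1≗ {L = λ t i → letter p t (pair n i)}
    ((λ {t} → proj₁ letters {t}) , λ i → proj₂ letters (pair n i)))
  where letters = letter-⇝ p-1

solutionᵀ : Mode → Total 1
solutionᵀ strong = oracleᵀ
solutionᵀ weak   = secondᵀ

functional-first : ∀ p q → functional firstᵀ ⟨ p , q ⟩ ≗ p
functional-first = ⟨,⟩-even

functional-solution : ∀ mode p q → functional (solutionᵀ mode) (input mode p q) ≗ q
functional-solution strong p q n = refl
functional-solution weak   p q n = ⟨,⟩-odd p q n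

-- In weak mode the outer functional receives a pair of tupled sequences; they become a sequence of
-- pairs, ready for parallel application.
zipᵀ : Mode → Total 1
zipᵀ strong = oracleᵀ
zipᵀ weak   = ifZeroᵀ ∙ (parityᵀ ∙ (sndᵀ ∷ [])
  ∷ firstᵀ ∙ (pairᵀ ∙ (fstᵀ ∷ halfᵀ ∙ (sndᵀ ∷ []) ∷ []) ∷ [])
  ∷ secondᵀ ∙ (pairᵀ ∙ (fstᵀ ∷ halfᵀ ∙ (sndᵀ ∷ []) ∷ []) ∷ []) ∷ [])

component-zip : ∀ mode p q n →
  component (functional (zipᵀ mode) (input mode p q)) n ≗ input mode (component p n) (component q n)
component-zip strong p q n k = refl
component-zip weak   p q n k = trans
  (cong (λ (n , k) → ifZero (parity k) (⟨ p , q ⟩ (2 * pair n (half k))) (⟨ p , q ⟩ (2 * pair n (half k) + 1)))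
        (unpair-pair n k))
  (trans (cong₂ (ifZero (parity k)) (⟨,⟩-even p q (pair n (half k))) (⟨,⟩-odd p q (pair n (half k))))
         (sym (⟨,⟩-parity (component p n) (component q n) k)))

-- In weak mode an ordinary name is interleaved with a completed one. Even letters are known at
-- once, hence the `suc`; odd letters wait for the completed name to deliver them.
mergeᵀ : Mode → Total 1
mergeᵀ strong = oracleᵀ
mergeᵀ weak   = emitᵀ (ifZeroᵀ ∙ (parityᵀ ∙ (var 1F ∷ [])
  ∷ sucᵀ ∙ (firstᵀ ∙ (halfᵀ ∙ (var 1F ∷ []) ∷ []) ∷ [])
  ∷ (letterᵀ ∘ᵀ secondᵀ) ∙ (var 0F ∷ halfᵀ ∙ (var 1F ∷ []) ∷ []) ∷ []))

merge-1≗ : ∀ mode p {t q} → t -1≗ q → functional (mergeᵀ mode) (input mode p t) -1≗ input mode p q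
merge-1≗ strong p         t-1 = t-1
merge-1≗ weak   p {t} {q} t-1 = emit-1≗
  ( (λ {s} {i} e → trans (sound s (parity i) (half i) e) (sym (⟨,⟩-parity p q i)))
  , λ i → let s₀ , late = proj₂ letters (half i) in
      s₀ , λ s le → trans (complete s (parity i) (half i) (late s le)) (cong suc (sym (⟨,⟩-parity p q i))))
  where
  t′ = functional secondᵀ ⟨ p , t ⟩
  letters : letter t′ ⇝ q
  letters = letter-⇝ (-1≗-respˡ (λ n → sym (functional-solution weak p t n)) t-1)
  sound : ∀ s a h {v} → ifZero a (suc (⟨ p , t ⟩ (2 * h))) (letter t′ s h) ≡ suc v →
          v ≡ ifZero a (p h) (q h)
  sound s zero    h e = trans (sym (suc-injective e)) (⟨,⟩-even p t h)
  sound s (suc _) h e = proj₁ letters {s} e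
  complete : ∀ s a h → letter t′ s h ≡ suc (q h) →
             ifZero a (suc (⟨ p , t ⟩ (2 * h))) (letter t′ s h) ≡ suc (ifZero a (p h) (q h))
  complete s zero    h e = cong suc (⟨,⟩-even p t h)
  complete s (suc _) h e = e

Equivalences : (Problem → Problem → Set₁) → Problem → Set₁
Equivalences _≼_ f =
    (f ≼ Σ (Π f) ⇔ (Π f ≼ Σ (Π f) × Σ (Π f) ≼ Π f))
  × (Σ (Π f) ≼ f ⇔ (Σ f ≼ Σ (Π f) × Σ (Π f) ≼ Σ f))
  × (f ≼ Π (Σ f) ⇔ (Π f ≼ Π (Σ f) × Π (Σ f) ≼ Π f))
  × (Π (Σ f) ≼ f ⇔ (Σ f ≼ Π (Σ f) × Π (Σ f) ≼ Σ f))

Equivalences-resp : ∀ {R S : Problem → Problem → Set₁} {f} → (∀ g h → R g h ⇔ S g h) →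
                    Equivalences S f → Equivalences R f
Equivalences-resp {R} {S} e (s₁ , s₂ , s₃ , s₄) = transfer s₁ , transfer s₂ , transfer s₃ , transfer s₄
  where
  transfer : ∀ {a b c d} → S a b ⇔ (S c d × S d c) → R a b ⇔ (R c d × R d c)
  transfer s = ⇔-trans (e _ _) (⇔-trans s (⇔-sym (e _ _ ×-⇔ e _ _)))

-- The reductions between composites of parallelization and stashing

module Reductions (em : ExcludedMiddle 0ℓ) (C : FunctionClass) (mode : Mode) where

  open FunctionClass C

  infix 4 _⊑_

  record _⊑_ (f g : Problem) : Set₁ where
    field
      {H K}    : Baire ⇀ Baire
      member-H : Member H
      member-K : Member K
      reduces  : ReducesPointwise mode H K f g

  open _⊑_

  ⟦⟧-intro : ∀ f {p q} → functional f p ≗ q → ⟦ code f ⟧ ∋ p ↦ q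
  ⟦⟧-intro f {p} e = _⇉_.resp (multi ⟦ code f ⟧) (λ _ → refl) e (⟦⟧-functional f p)

  -- Projecting the input of `H` to the solution turns a strong reduction into one of either mode,
  -- so each basic reduction below is given once, in strong form.
  strong⇒⊑ : ∀ {H K f g} → Member H → Member K → ReducesPointwise strong H K f g → f ⊑ g
  strong⇒⊑ {H} {f = f} {g} member-H member-K reduce = record
    { H        = H ∘⇀ ⟦ code (solutionᵀ mode) ⟧
    ; member-H = ∘-closed member-H (total (solutionᵀ mode))
    ; member-K = member-K
    ; reduces  = λ {p} p↦x d →
        let asks K∋ k↦z d′ answer = reduce p↦x d
        in asks K∋ k↦z d′ λ {t} t↦y y∈ →
          let answered H∋ u↦w w∈ = answer t↦y y∈
          in answered (t , ⟦⟧-intro (solutionᵀ mode) (functional-solution mode p t) , H∋) u↦w w∈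
    }

  infixr 5 _⊚_

  _⊚_ : ∀ {f g h} → f ⊑ g → g ⊑ h → f ⊑ h
  _⊚_ {f} {g} {h} f⊑g g⊑h = record
    { member-H = proj₁ (proj₂ (combined mode))
    ; member-K = ∘-closed (member-K g⊑h) (member-K f⊑g)
    ; reduces  = λ p↦x d →
        let asks K∋ k↦z d′ answer = reduces f⊑g p↦x d
            asks K∋′ k′↦z′ d″ answer′ = reduces g⊑h k↦z d′
        in asks (_ , K∋ , K∋′) k′↦z′ d″ λ t↦y y∈ →
          let answered H∋ u↦w w∈ = answer′ t↦y y∈
              answered H∋′ u′↦w′ w′∈ = answer u↦w w∈
          in answered (proj₂ (proj₂ (combined mode)) K∋ H∋ H∋′) u′↦w′ w′∈
    }
    where
    combined : ∀ mode → ∃ λ H″ → Member H″ × (∀ {p k t u v} → K f⊑g ∋ p ↦ k →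
      H g⊑h ∋ input mode k t ↦ u → H f⊑g ∋ input mode p u ↦ v → H″ ∋ input mode p t ↦ v)
    combined strong = H f⊑g ∘⇀ H g⊑h , ∘-closed (member-H f⊑g) (member-H g⊑h) , λ _ H∋ H∋′ → _ , H∋ , H∋′
    -- The inner `H` expects the intermediate query k paired with t, but only p and t are at hand; k
    -- is recomputed from p.
    combined weak   =
      H f⊑g ∘⇀ ⟨ ⟦ code firstᵀ ⟧ , H g⊑h ∘⇀ ⟨ K f⊑g ∘⇀ ⟦ code firstᵀ ⟧ , ⟦ code secondᵀ ⟧ ⟩⇀ ⟩⇀ ,
      ∘-closed (member-H f⊑g) (⟨,⟩-closed (total firstᵀ) (∘-closed (member-H g⊑h)
        (⟨,⟩-closed (∘-closed (member-K f⊑g) (total firstᵀ)) (total secondᵀ)))) ,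
      λ {p} {k} {t} {u} K∋ H∋ H∋′ →
        let first  = ⟦⟧-intro firstᵀ (functional-first p t)
            second = ⟦⟧-intro secondᵀ (functional-solution weak p t)
        in ⟨ p , u ⟩ ,
           (p , u , first , (⟨ k , t ⟩ , (k , t , (p , first , K∋) , second , λ _ → refl) , H∋) , λ _ → refl) ,
           H∋′

  Π-mono : ∀ {f g} → f ⊑ g → Π f ⊑ Π g
  Π-mono {f} {g} f⊑g = record
    { H        = parallel (H f⊑g) ∘⇀ ⟦ code (zipᵀ mode) ⟧
    ; K        = parallel (K f⊑g)
    ; member-H = ∘-closed (parallel-closed (member-H f⊑g)) (total (zipᵀ mode))
    ; member-K = parallel-closed (member-K f⊑g)
    ; reduces  = λ {p} {xs} p↦xs (ys , ys∈) →
        let q  = λ n → reduces f⊑g (p↦xs n) (ys n , ys∈ n)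
            ks = λ n → query (q n)
        in asks (ks , (λ n → Query.K∋ (q n)) , λ _ → refl)
                (λ n → name-resp (source g) (λ k → sym (component-tuple ks n k)) (Query.names (q n)))
                ((λ n → proj₁ (solvable (q n))) , λ n → proj₂ (solvable (q n)))
                λ {t} t↦ys ys∈ →
          let a  = λ n → answer (q n) (t↦ys n) (ys∈ n)
              us = λ n → output (a n)
          in answered
               ( functional (zipᵀ mode) (input mode p t) , ⟦⟧-functional (zipᵀ mode) _
               , us , (λ n → _⇉_.resp (multi (H f⊑g)) (λ k → sym (component-zip mode p t n k))
                               (λ _ → refl) (H∋ (a n)))
               , λ _ → refl )
               (λ n → name-resp (target f) (λ k → sym (component-tuple us n k)) (names (a n)))
               (λ n → solves (a n))
    }
    where
    open Query using (query; solvable; answer)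
    open Answer using (output; H∋; names; solves)

  -- Only the component n with a correct answer is controlled. Elsewhere the total `Ĥ` outputs a
  -- name of some element, possibly the bottom one, and stashing accepts any.
  Σ-mono : ∀ {f g} → f ⊑ g → Σ f ⊑ Σ g
  Σ-mono {f} {g} f⊑g = record
    { H        = parallel Ĥ ∘⇀ ⟦ code (zipᵀ mode) ⟧
    ; K        = parallel (K f⊑g)
    ; member-H = ∘-closed (parallel-closed member-Ĥ) (total (zipᵀ mode))
    ; member-K = parallel-closed (member-K f⊑g)
    ; reduces  = λ {p} {xs} p↦xs (_ , d , _) →
        let q  = λ n → reduces f⊑g (p↦xs n) (d n)
            ks = λ n → query (q n)
        in asks (ks , (λ n → Query.K∋ (q n)) , λ _ → refl)
                (λ n → name-resp (source g) (λ k → sym (component-tuple ks n k)) (Query.names (q n)))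
                (stashing-dom (fun g) λ n → solvable (q n))
                λ { {t} t↦ŷ (_ , n , y , ŷn≈y , y∈) →
          let us = λ n → proj₁ (Ĥ-total (input mode (component p n) (component t n)))
              ŵ  = λ n → proj₁ (completion-total em (target f) (us n))
              us↦ŵ = λ n → proj₂ (completion-total em (target f) (us n))
              s , t-1 , s↦y = completed-name (target g) (t↦ŷ n) ŷn≈y
              a  = answer (q n) s↦y y∈
          in answered
               ( functional (zipᵀ mode) (input mode p t) , ⟦⟧-functional (zipᵀ mode) _
               , us , (λ n → _⇉_.resp (multi Ĥ) (λ k → sym (component-zip mode p t n k))
                               (λ _ → refl) (proj₂ (Ĥ-total _)))
               , λ _ → refl )
               (λ n → name-resp (completion (target f)) (λ k → sym (component-tuple us n k)) (us↦ŵ n))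
               ( d , n , solution a
               -- The element `ŵ n` was picked by excluded middle; as a name determines its element,
               -- it is the solution found by `H`.
               , _⇀_.singleValued (δ (completion (target f))) {y′ = just (solution a)} (us↦ŵ n)
                   (output a , Ĥ-extends t-1 (H∋ a) (proj₂ (Ĥ-total _)) , names a)
               , solves a ) }
    }
    where
    open Query using (query; solvable; answer)
    open Answer using (output; solution; H∋; names; solves)

    completed = completion-closed (member-H f⊑g)
    F̂ = proj₁ completed
    open Completes (proj₂ (proj₂ completed))

    Ĥ : Baire ⇀ Baire
    Ĥ = F̂ ∘⇀ ⟦ code (mergeᵀ mode) ⟧

    member-Ĥ : Member Ĥ
    member-Ĥ = ∘-closed (proj₁ (proj₂ completed)) (total (mergeᵀ mode))

    Ĥ-total : ∀ p → ∃ λ r → Ĥ ∋ p ↦ r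
    Ĥ-total p = let r , h = isTotal (functional (mergeᵀ mode) p) in r , _ , ⟦⟧-functional (mergeᵀ mode) p , h

    Ĥ-extends : ∀ {p t q r r′} → t -1≗ q → H f⊑g ∋ input mode p q ↦ r → Ĥ ∋ input mode p t ↦ r′ → r′ -1≗ r
    Ĥ-extends {p} t-1 h (_ , m , ĥ) = extends
      (-1≗-respˡ (_⇀_.singleValued ⟦ code (mergeᵀ mode) ⟧ (⟦⟧-functional (mergeᵀ mode) _) m)
        (merge-1≗ mode p t-1))
      h ĥ

  f⊑Πf : ∀ f → f ⊑ Π f
  f⊑Πf f = strong⇒⊑ (total headᵀ) (total repeatᵀ) λ {p} p↦x (y , y∈) →
    asks (⟦⟧-functional repeatᵀ p)
         (λ n → name-resp (source f) (λ k → sym (component-repeat p n k)) p↦x)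
         ((λ _ → y) , λ _ → y∈)
         λ {t} t↦ys ys∈ → answered (⟦⟧-functional headᵀ t) (t↦ys 0) (ys∈ 0)

  -- Only instance 0 is solved. Its solution is copied to every place, and being right at place 0
  -- suffices.
  Σf⊑f : ∀ f → Σ f ⊑ f
  Σf⊑f f = strong⇒⊑ (total (sucᵀ ∙ (repeatᵀ ∷ []))) (total headᵀ) λ {p} p↦xs (_ , d , _) →
    asks (⟦⟧-functional headᵀ p) (p↦xs 0) (d 0)
         λ {t} {y} t↦y y∈ → answered (⟦⟧-functional (sucᵀ ∙ (repeatᵀ ∷ [])) t)
           (λ n → t , -1≗-respˡ (λ k → cong suc (sym (component-repeat t n k))) (suc-1≗ t) , t↦y)
           (d , 0 , y , Setoid.refl (space (completion (target f))) , y∈)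

  ΠΠf⊑Πf : ∀ f → Π (Π f) ⊑ Π f
  ΠΠf⊑Πf f = strong⇒⊑ (total curryᵀ) (total flattenᵀ) λ {p} {xs} p↦xs (yss , yss∈) →
    asks {posed = λ l → let n , k = unpair l in xs n k}
         (⟦⟧-functional flattenᵀ p)
         (λ l → name-resp (source f) (λ j → sym (component-flatten p l j)) (p↦xs _ _))
         ((λ l → let n , k = unpair l in yss n k) , λ l → yss∈ _ _)
         λ {t} {ys} t↦ys ys∈ → answered {solution = λ n k → ys (pair n k)}
           (⟦⟧-functional curryᵀ t)
           (λ n k → name-resp (target f) (λ j → sym (component-curry t n k j)) (t↦ys (pair n k)))
           (λ n k → subst (λ (n′ , k′) → ys (pair n k) ∈ fun f [ xs n′ k′ ])
                          (unpair-pair n k) (ys∈ (pair n k)))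

  -- Moves a completion from a sequence to its members. It is applied to all components alike, since
  -- which of them is correct is not known.
  Spread : Baire ⇀ Baire
  Spread = parallel ⟦ code spreadᵀ ⟧

  spread-all : ℕ^ℕ → ℕ^ℕ
  spread-all t = tuple (functional spreadᵀ ∘ component t)

  Spread∋ : ∀ t → Spread ∋ t ↦ spread-all t
  Spread∋ t = functional spreadᵀ ∘ component t , (λ n → ⟦⟧-functional spreadᵀ (component t n)) , λ _ → refl

  spread-all-1≗ : ∀ t {q} a → component t a -1≗ q →
                  ∀ n → component (component (spread-all t) a) n -1≗ component q n
  spread-all-1≗ t a t-1 n = -1≗-respˡ
    (λ k → sym (component-tuple (functional spreadᵀ ∘ component t) a (pair n k)))
    (spread-1≗ t-1 n)

  -- A solution of the curried instance has a correct row a and in it a correct entry c, under two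
  -- layers of completion. Spreading brings the outer layer to the entries, `pred` merges the two,
  -- and flattening puts the entry at `pair a c`.
  Σf⊑ΣΣf : ∀ f → Σ f ⊑ Σ (Σ f)
  Σf⊑ΣΣf f = strong⇒⊑ (∘-closed (total H-last) (parallel-closed (total spreadᵀ))) (total curryᵀ)
    λ {p} {xs} p↦xs (_ , d , _) →
    asks {posed = λ a c → xs (pair a c)}
         (⟦⟧-functional curryᵀ p)
         (λ a c → name-resp (source f) (λ j → sym (component-curry p a c j)) (p↦xs (pair a c)))
         (stashing-dom (stashing (fun f)) λ a → stashing-dom (fun f) λ c → d (pair a c))
         λ { {t} t↦ŷ (_ , a , ys , ŷa≈ys , (_ , c , y , ysc≈y , y∈)) →
    let u = functional H-last (spread-all t)
        q , t-1 , q↦ys = completed-name (completion (target f) ^ℕ) (t↦ŷ a) ŷa≈ys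
        s , q-1 , s↦y  = completed-name (target f) (q↦ys c) ysc≈y
        u-1 = -1≗-respˡ (λ j → cong pred (sym (component-flatten-pair (spread-all t) a c j)))
                        (pred-1≗ (spread-all-1≗ t a t-1 c) q-1)
        named = λ l → completion-total em (target f) (component u l)
    in answered (spread-all t , Spread∋ t , ⟦⟧-functional H-last (spread-all t))
         (λ l → proj₂ (named l))
         ( d , pair a c , y
         , _⇀_.singleValued (δ (completion (target f))) {y′ = just y} (proj₂ (named (pair a c))) (s , u-1 , s↦y)
         , y∈ ) }
    where
    H-last : Total 1
    H-last = predᵀ ∙ (flattenᵀ ∷ [])

  -- Each column is posed as an instance of `Π f`. A single correct column k answers every row at
  -- its place k, so the same k witnesses stashing in all rows.
  ΠΣf⊑ΣΠf : ∀ f → Π (Σ f) ⊑ Σ (Π f)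
  ΠΣf⊑ΣΠf f = strong⇒⊑ (∘-closed (total transposeᵀ) (parallel-closed (total spreadᵀ))) (total transposeᵀ)
    λ {p} {xs} p↦xs (_ , d) →
    asks {posed = λ k n → xs n k}
         (⟦⟧-functional transposeᵀ p)
         (λ k n → name-resp (source f) (λ j → sym (component-transpose p k n j)) (p↦xs n k))
         (stashing-dom (parallelization (fun f))
           λ k → (λ n → proj₁ (proj₁ (d n) k)) , λ n → proj₂ (proj₁ (d n) k))
         λ { {t} t↦ŷ (_ , k , ys , ŷk≈ys , ys∈) →
    let u = functional transposeᵀ (spread-all t)
        q , t-1 , q↦ys = completed-name (target f ^ℕ) (t↦ŷ k) ŷk≈ys
        u-1 = λ n → -1≗-respˡ (λ j → sym (component-transpose (spread-all t) n k j)) (spread-all-1≗ t k t-1 n)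
        named = λ n k → completion-total em (target f) (component (component u n) k)
    in answered (spread-all t , Spread∋ t , ⟦⟧-functional transposeᵀ (spread-all t))
         (λ n k → proj₂ (named n k))
         (λ n → proj₁ (d n) , k , ys n
              , _⇀_.singleValued (δ (completion (target f))) {y′ = just (ys n)} (proj₂ (named n k))
                  (component q n , u-1 n , q↦ys n)
              , ys∈ n) }

  equivalences : ∀ f → Equivalences _⊑_ f
  equivalences f =
      mk⇔ (λ h → Π-mono h ⊚ ΠΣf⊑ΣΠf (Π f) ⊚ Σ-mono (ΠΠf⊑Πf f) , Σf⊑f (Π f))
          (λ (h , _) → f⊑Πf f ⊚ h)
    , mk⇔ (λ h → Σ-mono (f⊑Πf f) , Σf⊑ΣΣf (Π f) ⊚ Σ-mono h)
          (λ (_ , h) → h ⊚ Σf⊑f f)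
    , mk⇔ (λ h → Π-mono h ⊚ ΠΠf⊑Πf (Σ f) , Π-mono (Σf⊑f f))
          (λ (h , _) → f⊑Πf f ⊚ h)
    , mk⇔ (λ h → f⊑Πf (Σ f) , Π-mono (Σf⊑ΣΣf f) ⊚ ΠΣf⊑ΣΠf (Σ f) ⊚ Σ-mono h)
          (λ (_ , h) → h ⊚ Σf⊑f f)

  via⇔⊑ : ∀ f g → (∃₂ λ H K → Member H × Member K × ReducesVia mode H K f g) ⇔ f ⊑ g
  via⇔⊑ f g = mk⇔
    (λ (_ , _ , member-H , member-K , via) → record
      { member-H = member-H ; member-K = member-K ; reduces = via⇒pointwise em mode {f = f} {g} via })
    (λ r → H r , K r , member-H r , member-K r , pointwise⇒via mode {f = f} {g} (reduces r))

  -- For the four choices of class and mode this relation unfolds to the corresponding `_≤[_]_`, so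
  -- the result applies without conversion.
  equivalences-via : ∀ f → Equivalences (λ f g → ∃₂ λ H K → Member H × Member K × ReducesVia mode H K f g) f
  equivalences-via f = Equivalences-resp via⇔⊑ (equivalences f)

corollary3p3 : ExcludedMiddle 0ℓ → (f : Problem) (r : Reducibility) →
    (f ≤[ r ] Σ (Π f) ⇔ Π f ≡[ r ] Σ (Π f))
    × (Σ (Π f) ≤[ r ] f ⇔ Σ f ≡[ r ] Σ (Π f))
    × (f ≤[ r ] Π (Σ f) ⇔ Π f ≡[ r ] Π (Σ f))
    × (Π (Σ f) ≤[ r ] f ⇔ Σ f ≡[ r ] Π (Σ f))
corollary3p3 em f sW  = Reductions.equivalences-via em computableFunctions strong f
corollary3p3 em f W   = Reductions.equivalences-via em computableFunctions weak f
corollary3p3 em f sW* = Reductions.equivalences-via em (continuousFunctions em) strong f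
corollary3p3 em f W*  = Reductions.equivalences-via em (continuousFunctions em) weak f
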